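{- For every even integer $n\geq 4$ and every integer $\delta$ with $\frac{n}{2}\le \delta\le n-1$, we have \[r_{\mathrm{odd}}(n,\delta;C_n)\ \leq\ \min\left\{2\delta-n+2,\ \frac{3\sqrt{2}}{2}\cdot\frac{\delta}{\sqrt{n}}+3\right\}.\]
   Context: Graphs are finite and simple; $v(G)$ and $\delta(G)$ denote the number of vertices and minimum degree of $G$. For graphs $G,H$, the odd-Ramsey number $r_{\mathrm{odd}}(G,H)$ is the minimum positive integer $r$ for which there is an edge-colouring of $G$ with $r$ colours (not required to be proper) such that every copy of $H$ in $G$ contains an odd number of edges of at least one colour. $C_n$ is the cycle on $n$ vertices. Define $r_{\mathrm{odd}}(n,\delta;C_n)=\min\{r_{\mathrm{odd}}(G,C_n): v(G)=n,\ \delta(G)\ge\delta\}$. -}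

module Defs where

open import Data.Bool.Base using (Bool; false; T; _∨_)
open import Data.Bool.Properties using (T?; ∨-comm)
open import Data.Fin.Base using (Fin; toℕ)
import Data.Fin.Base as Fin
import Data.Fin.Properties as Fin
open import Data.Fin.Subset using (∣_∣)
open import Data.Integer.Base using (+_)
open import Data.List.Base using (List; map; filter; length; allFin; cartesianProduct)
open import Data.List.Extrema.Nat using (min)
open import Data.Nat.Base using (ℕ; suc; _≤_; s≤s)
open import Data.Nat.DivMod using (_%_)
import Data.Nat.Properties as ℕ
open import Data.Product.Base using (Σ-syntax; ∃-syntax; _×_; _,_)
import Data.Rational.Unnormalised.Base as ℚ
open ℚ using (ℚᵘ; 0ℚᵘ)
import Data.Rational.Unnormalised.Properties as ℚ
open import Data.Sum.Base using (_⊎_; inj₁; inj₂)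
import Data.Vec.Base as Vec
open import Function.Definitions using (Injective)
open import Relation.Binary.PropositionalEquality using (_≡_; cong₂)
open import Relation.Nullary using (Dec; does; ¬_)
open import Relation.Nullary.Decidable using (dec-false; _×-dec_; _⊎-dec_)

record Graph (n : ℕ) : Set where
  field
    adj        : Fin n → Fin n → Bool
    adj-sym    : ∀ u v → adj u v ≡ adj v u
    adj-irrefl : ∀ v → adj v v ≡ false

open Graph public

degree : ∀ {n} → Graph n → Fin n → ℕ
degree G v = ∣ Vec.tabulate (adj G v) ∣

-- The start value n of the minimum never matters when n ≥ 1, as every degree
-- is below n.
minDegree : ∀ {n} → Graph n → ℕ
minDegree {n} G = min n (map (degree G) (allFin n))

-- Each edge is listed once, with its smaller endpoint first.
edges : ∀ {n} → Graph n → List (Fin n × Fin n)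
edges {n} G =
  filter (λ (u , v) → (u Fin.<? v) ×-dec T? (adj G u v))
         (cartesianProduct (allFin n) (allFin n))

CyclicSuc : ∀ {n} → Fin n → Fin n → Set
CyclicSuc {n} i j = suc (toℕ i) ≡ toℕ j ⊎ (suc (toℕ i) ≡ n × toℕ j ≡ 0)

cyclicSuc? : ∀ {n} (i j : Fin n) → Dec (CyclicSuc i j)
cyclicSuc? {n} i j =
  (suc (toℕ i) ℕ.≟ toℕ j) ⊎-dec ((suc (toℕ i) ℕ.≟ n) ×-dec (toℕ j ℕ.≟ 0))

cyclicSuc-irrefl : ∀ {n} → 3 ≤ n → (i : Fin n) → ¬ CyclicSuc i i
cyclicSuc-irrefl _ i (inj₁ eq) = ℕ.1+n≢n eq
cyclicSuc-irrefl (s≤s (s≤s _)) Fin.zero (inj₂ (() , _))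
cyclicSuc-irrefl _ (Fin.suc i) (inj₂ (_ , ()))

cycle : ∀ n → 3 ≤ n → Graph n
cycle n 3≤n = record
  { adj        = λ i j → does (cyclicSuc? i j) ∨ does (cyclicSuc? j i)
  ; adj-sym    = λ i j → ∨-comm (does (cyclicSuc? i j)) (does (cyclicSuc? j i))
  ; adj-irrefl = λ i → cong₂ _∨_ (no-loop i) (no-loop i)
  }
  where
  no-loop : ∀ i → does (cyclicSuc? i i) ≡ false
  no-loop i = dec-false (cyclicSuc? i i) (cyclicSuc-irrefl 3≤n i)

-- A copy of H in G, not necessarily induced, presented by a labelling of its
-- vertices by those of H; its edges are the images of the edges of H.
record Copy {m n} (H : Graph m) (G : Graph n) : Set where
  field
    vertex    : Fin m → Fin n
    injective : Injective _≡_ _≡_ vertex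
    edge      : ∀ i j → T (adj H i j) → T (adj G (vertex i) (vertex j))

open Copy public

-- The colours given to non-adjacent pairs are junk: only edges of G are ever
-- counted below.  For r ≥ 1 every colouring of the edges extends to such a
-- function.
record EdgeColouring {n} (G : Graph n) (r : ℕ) : Set where
  field
    colour     : Fin n → Fin n → Fin r
    colour-sym : ∀ u v → colour u v ≡ colour v u

open EdgeColouring public

colourCount : ∀ {m n r} {H : Graph m} {G : Graph n} →
              EdgeColouring G r → Copy H G → Fin r → ℕ
colourCount {H = H} χ f c =
  length (filter (λ (i , j) → colour χ (vertex f i) (vertex f j) Fin.≟ c)
                 (edges H))

OddColouring : ∀ {m n r} {G : Graph n} → Graph m → EdgeColouring G r → Set
OddColouring {r = r} {G} H χ =
  (f : Copy H G) → ∃[ c ] colourCount χ f c % 2 ≡ 1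

IsMin : (ℕ → Set) → ℕ → Set
IsMin P k = P k × (∀ l → P l → k ≤ l)

-- IsOddRamsey G H r: r = r_odd(G, H).
IsOddRamsey : ∀ {m n} → Graph n → Graph m → ℕ → Set
IsOddRamsey G H =
  IsMin (λ r → 1 ≤ r × (Σ[ χ ∈ EdgeColouring G r ] OddColouring H χ))

-- IsMinOddRamsey n δ H r: r = r_odd(n, δ; H).
IsMinOddRamsey : ∀ {m} → ℕ → ℕ → Graph m → ℕ → Set
IsMinOddRamsey n δ H =
  IsMin (λ r → Σ[ G ∈ Graph n ] δ ≤ minDegree G × IsOddRamsey G H r)

fromℕ : ℕ → ℚᵘ
fromℕ k = + k ℚ./ 1

-- a ≥√ k: a is a rational upper bound of the square root of k.
_≥√_ : ℚᵘ → ℕ → Set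
a ≥√ k = 0ℚᵘ ℚ.≤ a × fromℕ k ℚ.≤ a ℚ.* a

-- b ≤√ k: the positive rational b is a lower bound of the square root of k.
_≤√_ : (b : ℚᵘ) → .{{ℚ.Positive b}} → ℕ → Set
b ≤√ k = b ℚ.* b ℚ.≤ fromℕ k

-- min{2δ - n + 2, (3a/2)·(δ/b) + 3}, where a stands for √2 and b for √n.
boundAt : (n δ : ℕ) (a b : ℚᵘ) → .{{ℚ.Positive b}} → ℚᵘ
boundAt n δ a b =
  (fromℕ 2 ℚ.* fromℕ δ ℚ.- fromℕ n ℚ.+ fromℕ 2)
  ℚ.⊓ (((fromℕ 3 ℚ.* a) ℚ.÷ fromℕ 2) ℚ.* (fromℕ δ ℚ.÷ b) ℚ.+ fromℕ 3)
  where instance _ = ℚ.pos⇒nonZero b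

-- r ≤ min{2δ - n + 2, (3√2/2)·(δ/√n) + 3} as real numbers (for n ≥ 1).
-- boundAt is non-decreasing in a and non-increasing in b, so the real number on
-- the right is the infimum of boundAt n δ a b over rational a ≥ √2 and
-- 0 < b ≤ √n, and a number is at most an infimum iff it is at most every member.
_≤Bound[_,_] : ℕ → ℕ → ℕ → Set
r ≤Bound[ n , δ ] =
  ∀ a b .{{_ : ℚ.Positive b}} → a ≥√ 2 → b ≤√ n →
  fromℕ r ℚ.≤ boundAt n δ a b

{-# OPTIONS --safe #-}
-- Two constructions, one for each term of the minimum.
--
-- Linear bound, δ ≤ n - 2: let two cliques on δ + 1 vertices share the set
-- S = {x₀, …, x_{s-1}}, s = 2δ - n + 2, and let A and B be their private parts.
-- Colour the edges between x_i and A with i and all others with 0. If no colour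
-- is odd on a Hamilton cycle, each x_i with i ≥ 1 has both or none of its two
-- neighbours on the cycle in A, so that the cycle, followed from x₀, never
-- visits both A and B.
--
-- Square-root bound: split the vertices other than a special v into classes
-- indexed by H = F₂^m and fix D ⊆ H. Two vertices of classes g and g′ are
-- adjacent iff g + g′ ∈ D, and their edge has colour g + g′; the δ edges at v
-- are coloured so that the edges from v to one class have distinct colours.
-- The sum in H of the colours of a Hamilton cycle telescopes away from v, so if
-- no colour is odd then the two cycle neighbours of v lie in the same class,
-- and the colours at v show that they coincide. This uses about
-- |D| + δ/|H| ≈ δ (h/n + 1/h) colours, h = |H|, and a power of two h with
-- n/2 < h² ≤ 2n makes h/n + 1/h at most 3/√(2n). The case m = 0 gives the
-- linear bound for δ = n - 1.
module Submission where

open import Defs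
open import Algebra.Bundles using (module CommutativeRing; module CommutativeMonoid)
open import Data.Bool.Base using (Bool; true; false; T; _∧_; _∨_; _xor_; not; if_then_else_)
import Data.Bool.Properties as Bool
open import Data.Bool.Properties
  using (xor-assoc; xor-comm; xor-same; xor-identityʳ; xor-∧-commutativeRing;
         ∧-zeroʳ; ∧-identityʳ; ∧-distribˡ-xor; T?; T-∨; not-involutive)
open import Algebra.Properties.CommutativeSemigroup
  (CommutativeMonoid.commutativeSemigroup (CommutativeRing.+-commutativeMonoid xor-∧-commutativeRing))
  using () renaming (interchange to xor-interchange)
open import Data.Empty using (⊥; ⊥-elim)
open import Data.Fin.Base
  using (Fin; zero; suc; toℕ; inject₁; inject≤; fromℕ<; punchIn; punchOut; combine; remQuot; finToFun; funToFin)
  renaming (fromℕ to last)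
import Data.Fin.Properties as Fin
open import Data.Fin.Subset using (∣_∣)
open import Data.Integer.Base as ℤ using (+[1+_]; -[1+_]; +≤+) renaming (+_ to pos)
import Data.Integer.Properties as ℤ
open import Data.List.Base
  using (List; []; _∷_; _++_; _∷ʳ_; map; filter; length; lookup;
         allFin; tabulate; foldr; cartesianProduct; InitLast; initLast; _∷ʳ′_)
open import Data.List.Extrema.Nat using (min; v≤min⁺)
open import Data.List.Membership.Propositional using (_∈_; _∉_)
open import Data.List.Membership.Propositional.Properties
  using (∈-++⁺ʳ; ∈-++⁻; ∈-∃++; ∈-filter⁺; ∈-filter⁻; ∈-tabulate⁺; ∈-tabulate⁻; ∈-cartesianProduct⁺; ∈-allFin)
open import Data.List.Membership.Propositional.Properties.WithK using (unique∧set⇒bag)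
open import Data.List.Properties using (map-++; map-tabulate; map-cong; ++-assoc; filter-≐)
open import Data.List.Relation.Binary.BagAndSetEquality using (∼bag⇒↭)
open import Data.List.Relation.Binary.Permutation.Propositional using (_↭_; ↭⇒↭ₛ; module PermutationReasoning)
import Data.List.Relation.Binary.Permutation.Propositional.Properties as Perm
import Data.List.Relation.Binary.Permutation.Setoid.Properties as Permₛ
open import Data.List.Relation.Unary.All as All using (All; []; _∷_)
import Data.List.Relation.Unary.All.Properties as All
open import Data.List.Relation.Unary.AllPairs using ([]; _∷_)
open import Data.List.Relation.Unary.Any using (here; there; index)
open import Data.List.Relation.Unary.Any.Properties using (lookup-index)
open import Data.List.Relation.Unary.Unique.Propositional using (Unique)
import Data.List.Relation.Unary.Unique.Propositional.Properties as Unique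
open import Data.Nat.Base
  using (ℕ; zero; suc; _≤_; _<_; z≤n; s≤s; _*_; _∸_; _+_; _^_; _/_; _%_; NonZero; >-nonZero; >-nonZero⁻¹; ≢-nonZero)
open import Data.Nat.Divisibility using (_∣_)
open import Data.Nat.DivMod
  using (_mod_; m%n<n; m<n⇒m%n≡m; m≡m%n+[m/n]*n; /-monoˡ-≤; [m+kn]%n≡m%n; m/n*n≤m; m<n*o⇒m/o<n; n/1≡n)
import Data.Nat.Properties as ℕ
open import Data.Nat.Properties using (≤-trans; n≤1+n)
open import Data.Nat.Solver using (module +-*-Solver)
open import Data.Product.Base using (∃-syntax; Σ-syntax; ∃; ∃₂; _×_; _,_; proj₁; proj₂; uncurry)
open import Data.Rational.Unnormalised.Base as ℚ using (mkℚᵘ; *≤*)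
import Data.Rational.Unnormalised.Properties as ℚ
open import Data.Sum.Base using (_⊎_; inj₁; inj₂; [_,_]′)
import Data.Vec.Base as Vec
open import Data.Vec.Properties using (tabulate-cong)
open import Function.Base using (_∘_; case_of_)
open import Function.Bundles using (Equivalence; mk⇔)
open import Function.Definitions using (Injective)
open import Relation.Binary.PropositionalEquality
open import Relation.Nullary using (Dec; does; yes; no; ¬_; contradiction; _because_)
open import Relation.Nullary.Decidable using (dec-true; dec-false; does-⇔; map′; ¬?; _×-dec_; _→-dec_)

open +-*-Solver using (solve; _:=_; _:+_; _:*_; con)

-- Parity of colour counts along a Hamilton cycle

T-does : ∀ {P : Set} (P? : Dec P) → T (does P?) → P
T-does (yes p) _ = p

does-T : ∀ {P : Set} (P? : Dec P) → P → T (does P?)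
does-T P? p = subst T (sym (dec-true P? p)) _

module _ {A : Set} where

  xorSum : (A → Bool) → List A → Bool
  xorSum F = foldr (λ x b → F x xor b) false

  xorSum-++ : ∀ F xs ys → xorSum F (xs ++ ys) ≡ xorSum F xs xor xorSum F ys
  xorSum-++ F []       ys = refl
  xorSum-++ F (x ∷ xs) ys =
    trans (cong (F x xor_) (xorSum-++ F xs ys)) (sym (xor-assoc (F x) _ _))

  xorSum-false : ∀ F {xs} → All (λ x → F x ≡ false) xs → xorSum F xs ≡ false
  xorSum-false F []         = refl
  xorSum-false F (eq ∷ eqs) rewrite eq = xorSum-false F eqs

⨁ : ∀ {r} → (Fin r → Bool) → Bool
⨁ {zero}  F = false
⨁ {suc r} F = F zero xor ⨁ (F ∘ suc)

⨁-cong : ∀ {r} {F G : Fin r → Bool} → F ≗ G → ⨁ F ≡ ⨁ G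
⨁-cong {zero}  F≗G = refl
⨁-cong {suc r} F≗G = cong₂ _xor_ (F≗G zero) (⨁-cong (F≗G ∘ suc))

⨁-false : ∀ {r} {F : Fin r → Bool} → (∀ c → F c ≡ false) → ⨁ F ≡ false
⨁-false {zero}  F≗0 = refl
⨁-false {suc r} F≗0 rewrite F≗0 zero = ⨁-false (F≗0 ∘ suc)

⨁-xor : ∀ {r} (F G : Fin r → Bool) → ⨁ (λ c → F c xor G c) ≡ ⨁ F xor ⨁ G
⨁-xor {zero}  F G = refl
⨁-xor {suc r} F G = trans (cong ((F zero xor G zero) xor_) (⨁-xor (F ∘ suc) (G ∘ suc)))
                          (xor-interchange (F zero) _ _ _)

⨁-δ : ∀ {r} (F : Fin r → Bool) x → ⨁ (λ c → F c ∧ does (x Fin.≟ c)) ≡ F x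
⨁-δ F zero    = trans (cong₂ _xor_ (∧-identityʳ (F zero)) (⨁-false (λ c → ∧-zeroʳ (F (suc c)))))
                      (xor-identityʳ (F zero))
⨁-δ F (suc x) = trans (cong (_xor ⨁ (λ c → F (suc c) ∧ does (x Fin.≟ c))) (∧-zeroʳ (F zero)))
                      (⨁-δ (F ∘ suc) x)

AllEven : ∀ {r} → List (Fin r) → Set
AllEven cs = ∀ c → xorSum (λ x → does (x Fin.≟ c)) cs ≡ false

-- Each `F x` is the sum over `c` of `F c` times the indicator of `x ≡ c`; exchanging the two sums
-- groups the list by colour.
xorSum-by-colour : ∀ {r} (F : Fin r → Bool) cs →
                   xorSum F cs ≡ ⨁ (λ c → F c ∧ xorSum (λ x → does (x Fin.≟ c)) cs)
xorSum-by-colour F []       = sym (⨁-false (λ c → ∧-zeroʳ (F c)))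
xorSum-by-colour F (x ∷ cs) = begin
  F x xor xorSum F cs
    ≡⟨ cong₂ _xor_ (sym (⨁-δ F x)) (xorSum-by-colour F cs) ⟩
  ⨁ (λ c → F c ∧ does (x Fin.≟ c)) xor ⨁ (λ c → F c ∧ xorSum (λ y → does (y Fin.≟ c)) cs)
    ≡⟨ sym (⨁-xor (λ c → F c ∧ does (x Fin.≟ c)) (λ c → F c ∧ xorSum (λ y → does (y Fin.≟ c)) cs)) ⟩
  ⨁ (λ c → (F c ∧ does (x Fin.≟ c)) xor (F c ∧ xorSum (λ y → does (y Fin.≟ c)) cs))
    ≡⟨ ⨁-cong (λ c → sym (∧-distribˡ-xor (F c) _ _)) ⟩
  ⨁ (λ c → F c ∧ (does (x Fin.≟ c) xor xorSum (λ y → does (y Fin.≟ c)) cs)) ∎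
  where open ≡-Reasoning

-- This is the form in which evenness is used: every F₂-valued test function on the colours sums to
-- zero along the cycle, and each construction picks the tests that suit it.
AllEven⇒xorSum-false : ∀ {r} {cs : List (Fin r)} → AllEven cs → ∀ F → xorSum F cs ≡ false
AllEven⇒xorSum-false {cs = cs} even F = trans (xorSum-by-colour F cs)
  (⨁-false (λ c → trans (cong (F c ∧_) (even c)) (∧-zeroʳ (F c))))

parity : ℕ → Bool
parity zero    = false
parity (suc k) = not (parity k)

parity-odd : ∀ k → parity k ≡ true → k % 2 ≡ 1
parity-odd (suc zero)    _ = refl
parity-odd (suc (suc k)) p = parity-odd k (trans (sym (not-involutive (parity k))) p)

xorSum-count : ∀ {A : Set} {P : A → Set} (P? : ∀ x → Dec (P x)) xs →
               xorSum (does ∘ P?) xs ≡ parity (length (filter P? xs))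
xorSum-count P? []       = refl
xorSum-count P? (x ∷ xs) with P? x
... | true  because _ = cong not (xorSum-count P? xs)
... | false because _ = xorSum-count P? xs

length-filter-map : ∀ {A B : Set} {P : B → Set} (P? : ∀ x → Dec (P x)) (f : A → B) xs →
                    length (filter (P? ∘ f) xs) ≡ length (filter P? (map f xs))
length-filter-map P? f [] = refl
length-filter-map P? f (x ∷ xs) with P? (f x)
... | true  because _ = cong suc (length-filter-map P? f xs)
... | false because _ = length-filter-map P? f xs

-- Hamilton cycles as closed walks

module _ {A : Set} where

  steps : List A → List (A × A)
  steps []           = []
  steps (_ ∷ [])     = []
  steps (x ∷ y ∷ xs) = (x , y) ∷ steps (y ∷ xs)

  steps-++ : ∀ xs y ys → steps (xs ++ y ∷ ys) ≡ steps (xs ++ y ∷ []) ++ steps (y ∷ ys)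
  steps-++ []            y ys = refl
  steps-++ (x ∷ [])      y ys = refl
  steps-++ (x ∷ x′ ∷ xs) y ys = cong ((x , x′) ∷_) (steps-++ (x′ ∷ xs) y ys)

  steps-tabulate : ∀ m (g : Fin (suc m) → A) z →
                   steps (tabulate g ++ z ∷ []) ≡
                   tabulate (λ i → g (inject₁ i) , g (suc i)) ++ (g (last m) , z) ∷ []
  steps-tabulate zero    g z = refl
  steps-tabulate (suc m) g z = cong (_ ∷_) (steps-tabulate m (g ∘ suc) z)

  ∈-steps : ∀ {x y : A} xs → (x , y) ∈ steps xs → x ∈ xs × y ∈ xs
  ∈-steps (x ∷ y ∷ xs) (here refl) = here refl , there (here refl)
  ∈-steps (x ∷ y ∷ xs) (there p) with ∈-steps (y ∷ xs) p
  ... | p₁ , p₂ = there p₁ , there p₂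

-- The closing edge is written as `(zero , last m)` because `edges` puts the smaller endpoint first.
cycleEdges : ∀ m → List (Fin (suc m) × Fin (suc m))
cycleEdges m = (zero , last m) ∷ tabulate (λ i → inject₁ i , suc i)

T-∨ˡ : ∀ {x} y → T x → T (x ∨ y)
T-∨ˡ {true} y _ = _

T-∨ʳ : ∀ x {y} → T y → T (x ∨ y)
T-∨ʳ true  _ = _
T-∨ʳ false t = t

module _ {m} (3≤n : 3 ≤ suc m) where

  private
    C = cycle (suc m) 3≤n

  cycle-adj⁺ : ∀ {i j} → CyclicSuc i j ⊎ CyclicSuc j i → T (adj C i j)
  cycle-adj⁺ {i} {j} (inj₁ s) = T-∨ˡ _ (does-T (cyclicSuc? i j) s)
  cycle-adj⁺ {i} {j} (inj₂ s) = T-∨ʳ (does (cyclicSuc? i j)) (does-T (cyclicSuc? j i) s)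

  cycle-adj⁻ : ∀ {i j} → T (adj C i j) → CyclicSuc i j ⊎ CyclicSuc j i
  cycle-adj⁻ {i} {j} t with Equivalence.to T-∨ t
  ... | inj₁ t′ = inj₁ (T-does (cyclicSuc? i j) t′)
  ... | inj₂ t′ = inj₂ (T-does (cyclicSuc? j i) t′)

  cycle-adj-step : ∀ (i : Fin m) → T (adj C (inject₁ i) (suc i))
  cycle-adj-step i = cycle-adj⁺ (inj₁ (inj₁ (cong suc (Fin.toℕ-inject₁ i))))

  cycle-adj-close : T (adj C (last m) zero)
  cycle-adj-close = cycle-adj⁺ (inj₁ (inj₂ (cong suc (Fin.toℕ-fromℕ m) , refl)))

  private
    edge? : (e : Fin (suc m) × Fin (suc m)) → Dec _
    edge? (u , v) = (u Fin.<? v) ×-dec T? (adj C u v)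

    ∈⇒ : ∀ {e} → e ∈ edges C → e ∈ cycleEdges m
    ∈⇒ {u , v} e∈ with proj₂ (∈-filter⁻ edge? {xs = cartesianProduct (allFin _) (allFin _)} e∈)
    ∈⇒ {u , v} e∈ | u<v , t with cycle-adj⁻ {u} {v} t
    ∈⇒ {u , suc j} e∈ | u<v , t | inj₁ (inj₁ eq)
      with refl ← Fin.toℕ-injective {i = u} {j = inject₁ j} (trans (ℕ.suc-injective eq) (sym (Fin.toℕ-inject₁ j)))
      = there (∈-tabulate⁺ j)
    ∈⇒ {u , zero}  e∈ | () , t | _
    ∈⇒ {u , v} e∈ | u<v , t | inj₂ (inj₁ eq) = contradiction (subst (toℕ v <_) eq ℕ.≤-refl) (ℕ.<-asym u<v)
    ∈⇒ {zero , v} e∈ | u<v , t | inj₂ (inj₂ (eq , _))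
      with refl ← Fin.toℕ-injective {i = v} {j = last m} (trans (ℕ.suc-injective eq) (sym (Fin.toℕ-fromℕ m)))
      = here refl

    ⇐∈ : ∀ {e} → e ∈ cycleEdges m → e ∈ edges C
    ⇐∈ (here refl) = ∈-filter⁺ edge? (∈-cartesianProduct⁺ (∈-allFin _) (∈-allFin _))
      (subst (0 <_) (sym (Fin.toℕ-fromℕ m)) (ℕ.≤-trans (s≤s z≤n) (ℕ.≤-pred 3≤n)) ,
       cycle-adj⁺ (inj₂ (inj₂ (cong suc (Fin.toℕ-fromℕ m) , refl))))
    ⇐∈ (there e∈) with ∈-tabulate⁻ e∈
    ... | i , refl = ∈-filter⁺ edge? (∈-cartesianProduct⁺ (∈-allFin _) (∈-allFin _))
      (subst (_< suc (toℕ i)) (sym (Fin.toℕ-inject₁ i)) ℕ.≤-refl , cycle-adj-step i)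

    unique : Unique (cycleEdges m)
    unique = All.tabulate⁺ distinct ∷ Unique.tabulate⁺ (λ eq → Fin.suc-injective (cong proj₂ eq))
      where
      -- A coincidence would force `m` to be 1, against `3 ≤ suc m`.
      distinct : ∀ i → (zero , last m) ≢ (inject₁ i , Fin.suc i)
      distinct i eq = ℕ.<⇒≱ (ℕ.≤-pred 3≤n) (ℕ.≤-reflexive (begin
        m               ≡⟨ sym (Fin.toℕ-fromℕ m) ⟩
        toℕ (last m)    ≡⟨ cong (toℕ ∘ proj₂) eq ⟩
        suc (toℕ i)     ≡⟨ cong suc (sym (Fin.toℕ-inject₁ i)) ⟩
        suc (toℕ (inject₁ i)) ≡⟨ cong (suc ∘ toℕ ∘ proj₁) (sym eq) ⟩
        1 ∎))
        where open ≡-Reasoning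

  -- Two duplicate-free lists with the same members are permutations of each other, and colour
  -- counts see lists only up to permutation.
  edges-cycle : edges C ↭ cycleEdges m
  edges-cycle = ∼bag⇒↭ (unique∧set⇒bag
    (Unique.filter⁺ edge? (Unique.cartesianProduct⁺ (Unique.allFin⁺ _) (Unique.allFin⁺ _)))
    unique (mk⇔ ∈⇒ ⇐∈))

injective⇒covering : ∀ {n} {f : Fin n → Fin n} → Injective _≡_ _≡_ f → ∀ j → ∃[ i ] f i ≡ j
injective⇒covering {suc n} {f} inj j with Fin.any? (λ i → f i Fin.≟ j)
... | yes hit = hit
... | no  miss = contradiction
  (Fin.injective⇒≤ {f = λ i → punchOut {i = j} {j = f i} (λ eq → miss (i , sym eq))}
    (λ {i} {i′} eq → inj (Fin.punchOut-injective (λ e → miss (i , sym e)) (λ e → miss (i′ , sym e)) eq)))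
  (ℕ.<⇒≱ ℕ.≤-refl)

-- A Hamilton cycle cut open at `v`. The counts are a parameter of the type, so that moving the
-- starting vertex visibly keeps them.
record HamiltonWalk {n r} {G : Graph n} (χ : EdgeColouring G r) (v : Fin n)
                    (count : Fin r → ℕ) : Set where
  field
    rest     : List (Fin n)
    distinct : Unique (v ∷ rest)
    covers   : ∀ u → u ∈ v ∷ rest
    adjacent : All (T ∘ uncurry (adj G)) (steps (v ∷ rest ++ v ∷ []))
    counts   : ∀ c → count c ≡
               length (filter (Fin._≟ c) (map (uncurry (colour χ)) (steps (v ∷ rest ++ v ∷ []))))

  walkColours : List (Fin r)
  walkColours = map (uncurry (colour χ)) (steps (v ∷ rest ++ v ∷ []))

count-↭ : ∀ {r} (c : Fin r) {xs ys} → xs ↭ ys →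
          length (filter (Fin._≟ c) xs) ≡ length (filter (Fin._≟ c) ys)
count-↭ c p = Perm.↭-length (Perm.filter-↭ (Fin._≟ c) p)

module _ {n r} {G : Graph n} {χ : EdgeColouring G r} where

  -- Cutting the cycle at `v` instead of `u` exchanges the two arcs between them, so the vertices
  -- and the steps are only permuted.
  rotate : ∀ {u count} → HamiltonWalk χ u count → ∀ v → HamiltonWalk χ v count
  rotate {u} w v with HamiltonWalk.covers w v
  rotate {u} w v | here refl = w
  rotate {u} w v | there v∈ with ∈-∃++ v∈
  ... | l , r , eq with HamiltonWalk.rest w in eq′
  rotate {u} w v | there v∈ | l , r , refl | .(l ++ v ∷ r) = record
    { rest = r ++ u ∷ l
    ; distinct = swapped
    ; covers = λ x → Perm.∈-resp-↭ (Perm.++-comm (u ∷ l) (v ∷ r)) (subst (λ z → x ∈ u ∷ z) eq′ (HamiltonWalk.covers w x))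
    ; adjacent = Perm.All-resp-↭ turned (subst (λ z → All _ (steps (u ∷ z ++ u ∷ []))) eq′ (HamiltonWalk.adjacent w))
    ; counts = λ c → trans (HamiltonWalk.counts w c)
        (trans (cong (λ z → length (filter (Fin._≟ c) (map (uncurry (colour χ)) (steps (u ∷ z ++ u ∷ []))))) eq′)
          (count-↭ c (Perm.map⁺ _ turned)))
    }
    where
    swapped : Unique (v ∷ r ++ u ∷ l)
    swapped = Permₛ.Unique-resp-↭ (setoid (Fin n)) (↭⇒↭ₛ (Perm.++-comm (u ∷ l) (v ∷ r)))
      (subst (λ z → Unique (u ∷ z)) eq′ (HamiltonWalk.distinct w))
    turned : steps (u ∷ (l ++ v ∷ r) ++ u ∷ []) ↭ steps (v ∷ (r ++ u ∷ l) ++ v ∷ [])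
    turned = begin
      steps (u ∷ (l ++ v ∷ r) ++ u ∷ [])
        ≡⟨ cong (λ z → steps (u ∷ z)) (++-assoc l (v ∷ r) (u ∷ [])) ⟩
      steps ((u ∷ l) ++ v ∷ r ++ u ∷ [])
        ≡⟨ steps-++ (u ∷ l) v (r ++ u ∷ []) ⟩
      steps (u ∷ l ++ v ∷ []) ++ steps (v ∷ r ++ u ∷ [])
        ↭⟨ Perm.++-comm (steps (u ∷ l ++ v ∷ [])) _ ⟩
      steps (v ∷ r ++ u ∷ []) ++ steps (u ∷ l ++ v ∷ [])
        ≡⟨ sym (steps-++ (v ∷ r) u (l ++ v ∷ [])) ⟩
      steps (v ∷ r ++ u ∷ l ++ v ∷ [])
        ≡⟨ cong (λ z → steps (v ∷ z)) (sym (++-assoc r (u ∷ l) (v ∷ []))) ⟩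
      steps (v ∷ (r ++ u ∷ l) ++ v ∷ []) ∎
      where open PermutationReasoning

copy⇒walk : ∀ {m r} (3≤n : 3 ≤ suc m) {G : Graph (suc m)} (χ : EdgeColouring G r)
            (f : Copy (cycle (suc m) 3≤n) G) (v : Fin (suc m)) →
            HamiltonWalk χ v (colourCount χ f)
copy⇒walk {m} {r} 3≤n {G} χ f = rotate record
  { rest = tabulate (g ∘ suc)
  ; distinct = Unique.tabulate⁺ (injective f)
  ; covers = λ u → case injective⇒covering (injective f) u of λ where (i , refl) → ∈-tabulate⁺ {f = g} i
  ; adjacent = subst (All _) (sym (steps-tabulate m g (g zero)))
      (All.++⁺ (All.tabulate⁺ (λ i → edge f _ _ (cycle-adj-step 3≤n i))) (edge f _ _ (cycle-adj-close 3≤n) ∷ []))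
  ; counts = λ c → trans (length-filter-map (Fin._≟ c) (λ (i , j) → colour χ (g i) (g j)) (edges (cycle (suc m) 3≤n)))
      (count-↭ c colours)
  }
  where
  g = vertex f
  open PermutationReasoning
  col : Fin (suc m) × Fin (suc m) → Fin r
  col = λ (i , j) → colour χ (g i) (g j)
  colours : map col (edges (cycle (suc m) 3≤n)) ↭
            map (uncurry (colour χ)) (steps (tabulate g ++ g zero ∷ []))
  colours = begin
    map col (edges (cycle (suc m) 3≤n))
      ↭⟨ Perm.map⁺ col (edges-cycle 3≤n) ⟩
    col (zero , last m) ∷ map col (tabulate (λ i → inject₁ i , suc i))
      -- The walk traverses the closing edge from `last m` to `zero`, opposite to its listing.
      ≡⟨ cong₂ _∷_ (colour-sym χ _ _) (trans (map-tabulate _ col) (sym (map-tabulate _ (uncurry (colour χ))))) ⟩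
    colour χ (g (last m)) (g zero) ∷ map (uncurry (colour χ)) (tabulate (λ i → g (inject₁ i) , g (suc i)))
      ↭⟨ Perm.++-comm (_ ∷ []) _ ⟩
    map (uncurry (colour χ)) (tabulate (λ i → g (inject₁ i) , g (suc i))) ++ colour χ (g (last m)) (g zero) ∷ []
      ≡⟨ sym (map-++ (uncurry (colour χ)) (tabulate (λ i → g (inject₁ i) , g (suc i))) ((g (last m) , g zero) ∷ [])) ⟩
    map (uncurry (colour χ)) (tabulate (λ i → g (inject₁ i) , g (suc i)) ++ (g (last m) , g zero) ∷ [])
      ≡⟨ cong (map _) (sym (steps-tabulate m g (g zero))) ⟩
    map (uncurry (colour χ)) (steps (tabulate g ++ g zero ∷ [])) ∎

-- An odd colour is searched for among the finitely many; if there is none, the copy yields a walk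
-- from `v` with every colour even. Each construction chooses a convenient start `v`.
oddColouring : ∀ {m r} (3≤n : 3 ≤ suc m) {G : Graph (suc m)} (χ : EdgeColouring G r) (v : Fin (suc m)) →
  (∀ {count} (w : HamiltonWalk χ v count) → ¬ AllEven (HamiltonWalk.walkColours w)) →
  OddColouring (cycle (suc m) 3≤n) χ
oddColouring 3≤n χ v noEven f with Fin.any? (λ c → colourCount χ f c % 2 ℕ.≟ 1)
... | yes odd = odd
... | no ¬odd = ⊥-elim (noEven w (even w))
  where
  even : (w : HamiltonWalk χ v (colourCount χ f)) → AllEven (HamiltonWalk.walkColours w)
  even w c with xorSum (λ x → does (x Fin.≟ c)) (HamiltonWalk.walkColours w) in eq
  ... | false = refl
  ... | true  = contradiction (c , trans (cong (_% 2) (HamiltonWalk.counts w c))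
    (parity-odd (length (filter (Fin._≟ c) (HamiltonWalk.walkColours w)))
      (trans (sym (xorSum-count (Fin._≟ c) (HamiltonWalk.walkColours w))) eq))) ¬odd
  w : HamiltonWalk χ v (colourCount χ f)
  w = copy⇒walk 3≤n χ f v

-- Minimum degree and colourings from explicit data

injective⇒≤count : ∀ {k n} (P : Fin n → Bool) {e : Fin k → Fin n} → Injective _≡_ _≡_ e →
                   (∀ j → T (P (e j))) → k ≤ ∣ Vec.tabulate P ∣
injective⇒≤count {zero}  {n}     P     inj hit = z≤n
injective⇒≤count {suc k} {zero}  P {e} inj hit = contradiction (e zero) λ ()
injective⇒≤count {suc k} {suc n} P {e} inj hit with Fin.any? (λ j → e j Fin.≟ zero)
... | no miss = ℕ.≤-trans
  (injective⇒≤count (P ∘ suc) {λ j → punchOut (avoid j)}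
    (λ {i} {j} eq → inj (Fin.punchOut-injective (avoid i) (avoid j) eq))
    (λ j → subst (T ∘ P) (sym (Fin.punchIn-punchOut (avoid j))) (hit j)))
  (tail≤ (P zero) (Vec.tabulate (P ∘ suc)))
  where
  avoid : ∀ j → zero ≢ e j
  avoid j eq = miss (j , sym eq)
  tail≤ : ∀ b p → ∣ p ∣ ≤ ∣ b Vec.∷ p ∣
  tail≤ true  _ = ℕ.n≤1+n _
  tail≤ false _ = ℕ.≤-refl
... | yes (j₀ , eq₀) with P zero | subst (T ∘ P) eq₀ (hit j₀)
... | true | _ = s≤s (injective⇒≤count (P ∘ suc) {λ j → punchOut (avoid j)}
    (λ {i} {j} eq → Fin.punchIn-injective j₀ i j (inj (Fin.punchOut-injective (avoid i) (avoid j) eq)))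
    (λ j → subst (T ∘ P) (sym (Fin.punchIn-punchOut (avoid j))) (hit (punchIn j₀ j))))
  where
  avoid : ∀ j → zero ≢ e (punchIn j₀ j)
  avoid j eq = Fin.punchInᵢ≢i j₀ j (inj (trans (sym eq) (sym eq₀)))

δ≤minDegree : ∀ {n δ} (G : Graph n) → δ ≤ n →
              (∀ v → Σ[ e ∈ (Fin δ → Fin n) ] Injective _≡_ _≡_ e × (∀ j → T (adj G v (e j)))) →
              δ ≤ minDegree G
δ≤minDegree G δ≤n nbrs = v≤min⁺ δ≤n (All.map⁺ (All.tabulate⁺ λ v →
  let _ , inj , hit = nbrs v in injective⇒≤count (adj G v) inj hit))

module _ {n r} .{{_ : NonZero r}} (G : Graph n) (κ : Fin n → Fin n → ℕ) (κ-sym : ∀ u v → κ u v ≡ κ v u) where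

  -- Reducing modulo `r` makes the colouring total; `toℕ-colour` recovers `κ` wherever it is below
  -- `r`.
  colouring : EdgeColouring G r
  colouring = record { colour = λ u v → κ u v mod r ; colour-sym = λ u v → cong (_mod r) (κ-sym u v) }

  toℕ-colour : ∀ {u v} → κ u v < r → toℕ (colour colouring u v) ≡ κ u v
  toℕ-colour {u} {v} κ< = trans (Fin.toℕ-fromℕ< (m%n<n (κ u v) r)) (m<n⇒m%n≡m κ<)

xor-cancelˡ : ∀ a {b c} → a xor b ≡ a xor c → b ≡ c
xor-cancelˡ false eq = eq
xor-cancelˡ true {false} {false} eq = refl
xor-cancelˡ true {true} {true} eq = refl

xor-false⇒≡ : ∀ {a b} → a xor b ≡ false → a ≡ b
xor-false⇒≡ {false} {false} _ = refl
xor-false⇒≡ {true}  {true}  _ = refl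

covers⇒≤length : ∀ {n} {xs : List (Fin n)} → (∀ u → u ∈ xs) → n ≤ length xs
covers⇒≤length {xs = xs} covers = Fin.injective⇒≤ {f = index ∘ covers} λ {u} {v} eq →
  trans (lookup-index (covers u)) (trans (cong (lookup xs) eq) (sym (lookup-index (covers v))))

xorSum-map : ∀ {A B : Set} (F : B → Bool) (f : A → B) xs → xorSum F (map f xs) ≡ xorSum (F ∘ f) xs
xorSum-map F f []       = refl
xorSum-map F f (x ∷ xs) = cong (F (f x) xor_) (xorSum-map F f xs)

-- Every interior potential `φ z` appears in two consecutive steps and cancels.
xorSum-telescope : ∀ {A : Set} (F : A × A → Bool) (φ : A → Bool) x ys y →
  All (λ (a , b) → F (a , b) ≡ φ a xor φ b) (steps (x ∷ ys ++ y ∷ [])) →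
  xorSum F (steps (x ∷ ys ++ y ∷ [])) ≡ φ x xor φ y
xorSum-telescope F φ x []       y (eq ∷ []) = trans (xor-identityʳ _) eq
xorSum-telescope F φ x (z ∷ zs) y (eq ∷ eqs) = begin
  F (x , z) xor xorSum F (steps (z ∷ zs ++ y ∷ []))
    ≡⟨ cong₂ _xor_ eq (xorSum-telescope F φ z zs y eqs) ⟩
  (φ x xor φ z) xor (φ z xor φ y)
    ≡⟨ xor-assoc (φ x) (φ z) _ ⟩
  φ x xor (φ z xor (φ z xor φ y))
    ≡⟨ cong (φ x xor_) (sym (xor-assoc (φ z) (φ z) (φ y))) ⟩
  φ x xor ((φ z xor φ z) xor φ y)
    ≡⟨ cong (λ b → φ x xor (b xor φ y)) (xor-same (φ z)) ⟩
  φ x xor φ y ∎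
  where open ≡-Reasoning

-- The two cycle edges at a fixed vertex

module _ {n r} {G : Graph n} (χ : EdgeColouring G r) where

  -- What evenness gives for the edges from `v` to `x` and `y`, for tests `F` that are differences
  -- of a potential `φ` on all edges avoiding `v`. The rest of the cycle no longer appears.
  Cherry : Fin n → Fin n → Fin n → Set
  Cherry v x y = ∀ (F : Fin r → Bool) (φ : Fin n → Bool) →
    (∀ {a b} → a ≢ v → b ≢ v → T (adj G a b) → F (colour χ a b) ≡ φ a xor φ b) →
    F (colour χ v x) xor φ x ≡ F (colour χ v y) xor φ y

  -- Without `v` the cycle is a path from `x` to `y`, along which the test telescopes to
  -- `φ x xor φ y`; the total over the whole cycle is zero.
  cherry : ∀ {v count} → 3 ≤ n → (w : HamiltonWalk χ v count) → AllEven (HamiltonWalk.walkColours w) →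
           ∃₂ λ x y → x ≢ y × T (adj G v x) × T (adj G v y) × Cherry v x y
  cherry {v} 3≤n w even = main rest refl (initLast rest)
    where
    open HamiltonWalk w
    main : ∀ zs → rest ≡ zs → InitLast zs → _
    -- A walk on only one or two vertices contradicts `3 ≤ n`, so the two neighbours of `v` on the
    -- cycle are different.
    main .[] eq [] =
      ⊥-elim (ℕ.<⇒≱ (s≤s (s≤s z≤n)) (ℕ.≤-trans 3≤n (subst (λ z → n ≤ length (v ∷ z)) eq (covers⇒≤length covers))))
    main .([] ∷ʳ y) eq ([] ∷ʳ′ y) =
      ⊥-elim (ℕ.<⇒≱ (s≤s (s≤s (s≤s z≤n))) (ℕ.≤-trans 3≤n (subst (λ z → n ≤ length (v ∷ z)) eq (covers⇒≤length covers))))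
    main .((x ∷ ys) ∷ʳ y) eq ((x ∷ ys) ∷ʳ′ y) = x , y , x≢y , vx , subst T (adj-sym G y v) yv , sum
      where
      inner = steps (x ∷ ys ++ y ∷ [])
      shape : steps (v ∷ rest ++ v ∷ []) ≡ (v , x) ∷ inner ++ (y , v) ∷ []
      shape = trans (cong (λ z → steps (v ∷ z ++ v ∷ [])) eq) (cong ((v , x) ∷_)
        (trans (cong (λ z → steps (x ∷ z)) (++-assoc ys (y ∷ []) (v ∷ []))) (steps-++ (x ∷ ys) y (v ∷ []))))
      adj′ : All (T ∘ uncurry (adj G)) ((v , x) ∷ inner ++ (y , v) ∷ [])
      adj′ = subst (All _) shape adjacent
      vx : T (adj G v x)
      vx = All.head adj′
      yv : T (adj G y v)
      yv = All.head (All.++⁻ʳ inner (All.tail adj′))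
      uniq : Unique (v ∷ x ∷ ys ++ y ∷ [])
      uniq = subst (λ z → Unique (v ∷ z)) eq distinct
      x≢y : x ≢ y
      x≢y with uniq
      ... | _ ∷ (x∉ ∷ _) = All.lookup x∉ (∈-++⁺ʳ ys (here refl))
      v≢ : ∀ {a} → a ∈ x ∷ ys ++ y ∷ [] → a ≢ v
      v≢ a∈ a≡v with uniq
      ... | v∉ ∷ _ = All.lookup v∉ a∈ (sym a≡v)
      sum : Cherry v x y
      sum F φ hyp = xor-false⇒≡ (begin
        (f (v , x) xor φ x) xor (F (colour χ v y) xor φ y)
          ≡⟨ cong (λ c → (f (v , x) xor φ x) xor (F c xor φ y)) (colour-sym χ v y) ⟩
        (f (v , x) xor φ x) xor (f (y , v) xor φ y)
          ≡⟨ xor-assoc (f (v , x)) (φ x) _ ⟩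
        f (v , x) xor (φ x xor (f (y , v) xor φ y))
          ≡⟨ cong (λ z → f (v , x) xor (φ x xor z)) (xor-comm (f (y , v)) (φ y)) ⟩
        f (v , x) xor (φ x xor (φ y xor f (y , v)))
          ≡⟨ cong (f (v , x) xor_) (sym (xor-assoc (φ x) (φ y) _)) ⟩
        f (v , x) xor ((φ x xor φ y) xor f (y , v))
          ≡⟨ cong₂ (λ z z′ → f (v , x) xor (z xor z′)) (sym (xorSum-telescope f φ x ys y inner-eq)) (sym (xor-identityʳ _)) ⟩
        f (v , x) xor (xorSum f inner xor xorSum f ((y , v) ∷ []))
          ≡⟨ cong (f (v , x) xor_) (sym (xorSum-++ f inner _)) ⟩
        xorSum f ((v , x) ∷ inner ++ (y , v) ∷ [])
          ≡⟨ cong (xorSum f) (sym shape) ⟩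
        xorSum f (steps (v ∷ rest ++ v ∷ []))
          ≡⟨ sym (xorSum-map F (uncurry (colour χ)) (steps (v ∷ rest ++ v ∷ []))) ⟩
        xorSum F walkColours
          ≡⟨ AllEven⇒xorSum-false {cs = walkColours} even F ⟩
        false ∎)
        where
        open ≡-Reasoning
        f : Fin n × Fin n → Bool
        f = F ∘ uncurry (colour χ)
        inner-eq : All (λ (a , b) → f (a , b) ≡ φ a xor φ b) inner
        inner-eq = All.tabulate λ {e} e∈ →
          let a∈ , b∈ = ∈-steps (x ∷ ys ++ y ∷ []) e∈ in
          hyp (v≢ a∈) (v≢ b∈) (All.lookup (All.++⁻ˡ inner (All.tail adj′)) e∈)


-- Existence of the minimum

least : ∀ {P : ℕ → Set} → (∀ k → Dec (P k)) → ∀ {k} → P k → ∃[ r ] IsMin P r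
least P? {k} p with P? 0
... | yes p₀ = 0 , p₀ , λ _ _ → z≤n
least P? {zero}  p | no ¬p₀ = contradiction p ¬p₀
least {P} P? {suc k} p | no ¬p₀ with least {P ∘ suc} (P? ∘ suc) p
... | r , pr , r-min = suc r , pr , λ where
  zero    q → contradiction q ¬p₀
  (suc l) q → s≤s (r-min l q)

module _ {m k} {P : (Fin m → Fin k) → Set} (P? : ∀ f → Dec (P f))
         (resp : ∀ {f g} → f ≗ g → P f → P g) where

  -- The functions are enumerated by their codes. A function and its decoded code agree only
  -- pointwise, which is why `P` has to respect `_≗_`.
  anyFun? : Dec (∃ P)
  anyFun? = map′ (λ (i , p) → finToFun i , p)
                 (λ (f , p) → funToFin f , resp (sym ∘ Fin.finToFun-funToFin f) p)
                 (Fin.any? (P? ∘ finToFun))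

  allFun? : Dec (∀ f → P f)
  allFun? = map′ (λ p f → resp (Fin.finToFun-funToFin f) (p (funToFin f)))
                 (λ p i → p (finToFun i))
                 (Fin.all? (P? ∘ finToFun))

anyFun₂? : ∀ {n k} {P : (Fin n → Fin n → Fin k) → Set} → (∀ f → Dec (P f)) →
           (∀ {f g} → (∀ i j → f i j ≡ g i j) → P f → P g) → Dec (∃ P)
anyFun₂? {n} {k} {P} P? resp = map′
  (λ (f , p) → unflatten f , p)
  (λ (f , p) → uncurry f ∘ remQuot n ,
    resp (λ i j → sym (cong (uncurry f) (Fin.remQuot-combine i j))) p)
  (anyFun? (P? ∘ unflatten) (λ eq → resp (λ i j → eq (combine i j))))
  where
  unflatten : (Fin (n * n) → Fin k) → Fin n → Fin n → Fin k
  unflatten f i j = f (combine i j)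

bit : Fin 2 → Bool
bit zero    = false
bit (suc _) = true

unbit : Bool → Fin 2
unbit false = zero
unbit true  = suc zero

bit-unbit : ∀ b → bit (unbit b) ≡ b
bit-unbit false = refl
bit-unbit true  = refl

anyRel? : ∀ {n} {P : (Fin n → Fin n → Bool) → Set} → (∀ f → Dec (P f)) →
          (∀ {f g} → (∀ i j → f i j ≡ g i j) → P f → P g) → Dec (∃ P)
anyRel? {P = P} P? resp = map′
  (λ (f , p) → (λ i j → bit (f i j)) , p)
  (λ (f , p) → (λ i j → unbit (f i j)) , resp (λ i j → sym (bit-unbit (f i j))) p)
  (anyFun₂? (λ f → P? (λ i j → bit (f i j))) (λ eq → resp (λ i j → cong bit (eq i j))))

OddColourable : ∀ {m} → ℕ → ℕ → Graph m → ℕ → Set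
OddColourable n δ H r =
  1 ≤ r × (Σ[ G ∈ Graph n ] δ ≤ minDegree G × (Σ[ χ ∈ EdgeColouring G r ] OddColouring H χ))

module _ {m} (n δ : ℕ) (H : Graph m) (r : ℕ) where

  private
    Rel   = Fin n → Fin n → Bool
    Col   = Fin n → Fin n → Fin r

    count : Col → (Fin m → Fin n) → Fin r → ℕ
    count κ f c = length (filter (λ (i , j) → κ (f i) (f j) Fin.≟ c) (edges H))

    -- The conditions of the records are restated for bare functions, so that the search can range
    -- over functions and the conditions transfer along pointwise equality.
    IsGraph : Rel → Set
    IsGraph α = (∀ u v → α u v ≡ α v u) × (∀ v → α v v ≡ false) ×
                δ ≤ min n (map (λ v → ∣ Vec.tabulate (α v) ∣) (allFin n))

    IsCopy : Rel → (Fin m → Fin n) → Set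
    IsCopy α f = (∀ i j → f i ≡ f j → i ≡ j) × (∀ i j → T (adj H i j) → T (α (f i) (f j)))

    IsOdd : Rel → Col → Set
    IsOdd α κ = (∀ u v → κ u v ≡ κ v u) ×
                (∀ f → IsCopy α f → ∃[ c ] count κ f c % 2 ≡ 1)

    count-cong : ∀ {κ κ′ f f′} → (∀ i j → κ i j ≡ κ′ i j) → f ≗ f′ → ∀ c →
                 count κ f c ≡ count κ′ f′ c
    count-cong {κ} {κ′} {f} {f′} κ≗κ′ f≗f′ c =
      cong length (filter-≐ _ _ ((λ {e} eq → trans (sym (same e)) eq) , (λ {e} eq → trans (same e) eq)) (edges H))
      where
      same : ∀ e → κ (f (proj₁ e)) (f (proj₂ e)) ≡ κ′ (f′ (proj₁ e)) (f′ (proj₂ e))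
      same (i , j) = trans (cong₂ κ (f≗f′ i) (f≗f′ j)) (κ≗κ′ _ _)

    isGraph? : ∀ α → Dec (IsGraph α)
    isGraph? α = Fin.all? (λ u → Fin.all? λ v → α u v Bool.≟ α v u) ×-dec
                 Fin.all? (λ v → α v v Bool.≟ false) ×-dec
                 (δ ℕ.≤? _)

    isGraph-resp : ∀ {α α′} → (∀ i j → α i j ≡ α′ i j) → IsGraph α → IsGraph α′
    isGraph-resp eq (s , i , d) =
      (λ u v → trans (sym (eq u v)) (trans (s u v) (eq v u))) ,
      (λ v → trans (sym (eq v v)) (i v)) ,
      subst (δ ≤_) (cong (min n) (map-cong (λ v → cong ∣_∣ (tabulate-cong (eq v))) (allFin n))) d

    isCopy? : ∀ α f → Dec (IsCopy α f)
    isCopy? α f =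
      Fin.all? (λ i → Fin.all? λ j → (f i Fin.≟ f j) →-dec (i Fin.≟ j)) ×-dec
      Fin.all? (λ i → Fin.all? λ j → T? (adj H i j) →-dec T? (α (f i) (f j)))

    isCopy-resp : ∀ {α α′ f f′} → (∀ i j → α i j ≡ α′ i j) → f ≗ f′ →
                  IsCopy α f → IsCopy α′ f′
    isCopy-resp {α} αeq feq (inj , e) =
      (λ i j eq → inj i j (trans (feq i) (trans eq (sym (feq j))))) ,
      (λ i j t → subst T (trans (cong₂ α (feq i) (feq j)) (αeq _ _)) (e i j t))

    isOdd? : ∀ α κ → Dec (IsOdd α κ)
    isOdd? α κ = Fin.all? (λ u → Fin.all? λ v → κ u v Fin.≟ κ v u) ×-dec
      allFun? (λ f → isCopy? α f →-dec Fin.any? (λ c → count κ f c % 2 ℕ.≟ 1))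
              (λ {f} {g} eq odd copy → let c , p = odd (isCopy-resp {α} {α} {g} {f} (λ _ _ → refl) (sym ∘ eq) copy) in
                c , trans (cong (_% 2) (sym (count-cong {κ} {κ} {f} {g} (λ _ _ → refl) eq c))) p)

    isOdd-resp : ∀ {α α′ κ κ′} → (∀ i j → α i j ≡ α′ i j) → (∀ i j → κ i j ≡ κ′ i j) →
                 IsOdd α κ → IsOdd α′ κ′
    isOdd-resp {α} {α′} {κ} {κ′} αeq κeq (s , odd) =
      (λ u v → trans (sym (κeq u v)) (trans (s u v) (κeq v u))) ,
      λ f copy → let c , p = odd f (isCopy-resp {α′} {α} {f} {f} (λ i j → sym (αeq i j)) (λ _ → refl) copy) in
        c , trans (cong (_% 2) (sym (count-cong {κ} {κ′} {f} {f} κeq (λ _ → refl) c))) p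

  -- There are finitely many relations and colourings on `n` vertices, so exhaustive search decides
  -- the question; this makes the least number of colours exist constructively once some number is
  -- exhibited.
  oddColourable? : Dec (OddColourable n δ H r)
  oddColourable? = map′ to from
    ((1 ℕ.≤? r) ×-dec anyRel? (λ α → isGraph? α ×-dec anyFun₂? (isOdd? α) (isOdd-resp {α} {α} (λ _ _ → refl)))
      (λ eq (g , κ , odd) → isGraph-resp eq g , κ , isOdd-resp eq (λ _ _ → refl) odd))
    where
    to : _ → OddColourable n δ H r
    to (1≤r , α , (s , i , d) , κ , κs , odd) =
      1≤r , record { adj = α ; adj-sym = s ; adj-irrefl = i } , d ,
      record { colour = κ ; colour-sym = κs } ,
      λ f → odd (vertex f) ((λ _ _ → injective f) , edge f)
    from : OddColourable n δ H r → _
    from (1≤r , G , d , χ , odd) =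
      1≤r , adj G , (adj-sym G , adj-irrefl G , d) , colour χ , colour-sym χ ,
      λ f (inj , e) → odd (record { vertex = f ; injective = λ {i} {j} → inj i j ; edge = e })

-- The minimum over graphs of the minimum over colourings is attained by the
-- best pair of a graph and a colouring.
minOddRamsey : ∀ {m n δ} {H : Graph m} {k} → OddColourable n δ H k →
               ∃[ r ] IsMinOddRamsey n δ H r × (∀ l → OddColourable n δ H l → r ≤ l)
minOddRamsey {n = n} {δ} {H} ok with least (oddColourable? n δ H) ok
... | r , (1≤r , G , d , χ , odd) , r-min =
  r ,
  ( ( G , d , (1≤r , χ , odd) , λ l (1≤l , χ′ , odd′) → r-min l (1≤l , G , d , χ′ , odd′) )
  , λ l (G′ , d′ , (1≤l , χ′ , odd′) , _) → r-min l (1≤l , G′ , d′ , χ′ , odd′) ) ,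
  r-min

-- A star over the classes of an elementary abelian 2-group

-- The group F₂^`dim` carried by `Fin h` and given by its coordinates. `⊕-self` puts the neutral
-- element at number 0, so that a final segment of numbers starting above 0 misses it.
record XorGroup (h : ℕ) : Set where
  field
    dim     : ℕ
    coord   : Fin dim → Fin h → Bool
    _⊕_     : Fin h → Fin h → Fin h
    coord-⊕ : ∀ j x y → coord j (x ⊕ y) ≡ coord j x xor coord j y
    ext     : ∀ {x y} → (∀ j → coord j x ≡ coord j y) → x ≡ y
    ⊕-self  : ∀ x → toℕ (x ⊕ x) ≡ 0

  ⊕-comm : ∀ x y → x ⊕ y ≡ y ⊕ x
  ⊕-comm x y = ext λ j → trans (coord-⊕ j x y) (trans (xor-comm (coord j x) (coord j y)) (sym (coord-⊕ j y x)))

  ⊕-cancel : ∀ x y → x ⊕ (x ⊕ y) ≡ y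
  ⊕-cancel x y = ext λ j → trans (coord-⊕ j x (x ⊕ y)) (trans (cong (coord j x xor_) (coord-⊕ j x y))
    (trans (sym (xor-assoc (coord j x) _ _)) (cong (_xor coord j y) (xor-same (coord j x)))))

funToFin-zero : ∀ {m} (f : Fin m → Fin 2) → (∀ j → f j ≡ zero) → toℕ (funToFin f) ≡ 0
funToFin-zero {zero}  f f≗0 = refl
funToFin-zero {suc m} f f≗0 = begin
  toℕ (combine (f zero) (funToFin (f ∘ suc)))          ≡⟨ Fin.toℕ-combine (f zero) (funToFin (f ∘ suc)) ⟩
  2 ^ m * toℕ (f zero) + toℕ (funToFin (f ∘ suc))      ≡⟨ cong₂ (λ x y → 2 ^ m * toℕ x + y) (f≗0 zero) (funToFin-zero (f ∘ suc) (f≗0 ∘ suc)) ⟩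
  2 ^ m * 0 + 0                                        ≡⟨ trans (ℕ.+-identityʳ _) (ℕ.*-zeroʳ (2 ^ m)) ⟩
  0 ∎
  where open ≡-Reasoning

funToFin-cong : ∀ {m k} {f g : Fin m → Fin k} → f ≗ g → funToFin f ≡ funToFin g
funToFin-cong {zero}  f≗g = refl
funToFin-cong {suc m} f≗g = cong₂ combine (f≗g zero) (funToFin-cong (f≗g ∘ suc))

bit-injective : ∀ {x y} → bit x ≡ bit y → x ≡ y
bit-injective {zero}     {zero}     _ = refl
bit-injective {suc zero} {suc zero} _ = refl

binary : ∀ m → XorGroup (2 ^ m)
binary m = record
  { dim     = m
  ; coord   = λ j x → bit (finToFun {2} {m} x j)
  ; _⊕_     = λ x y → funToFin (sum x y)
  ; coord-⊕ = λ j x y → trans (cong bit (Fin.finToFun-funToFin (sum x y) j)) (bit-unbit _)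
  ; ext     = λ {x} {y} eq → trans (sym (Fin.funToFin-finToFin {m} {2} x))
                (trans (funToFin-cong (λ j → bit-injective (eq j))) (Fin.funToFin-finToFin {m} {2} y))
  ; ⊕-self  = λ x → funToFin-zero (sum x x) (λ j → cong unbit (xor-same (bit (finToFun {2} {m} x j))))
  }
  where
  sum : Fin (2 ^ m) → Fin (2 ^ m) → Fin m → Fin 2
  sum x y j = unbit (bit (finToFun {2} {m} x j) xor bit (finToFun {2} {m} y j))

divMod-injective : ∀ a b h .{{_ : NonZero h}} → a % h ≡ b % h → a / h ≡ b / h → a ≡ b
divMod-injective a b h rem quot =
  trans (m≡m%n+[m/n]*n a h) (trans (cong₂ (λ r q → r + q * h) rem quot) (sym (m≡m%n+[m/n]*n b h)))

-- Vertex zero is the special vertex, suc i lies in the class i mod h, and D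
-- consists of the elements numbered c or higher: for c = 0 all pairs of
-- vertices suc i are adjacent, otherwise 0 ∉ D and the classes are independent.
module StarOverClasses {h} .{{_ : NonZero h}} (X : XorGroup h) (N c δ′ : ℕ) (c<h : c < h) (δ≤N : suc δ′ ≤ N) where

  open XorGroup X

  -- `d` is the size of D. The neighbours `suc i` of the special vertex have `toℕ i` up to `δ′`, so
  -- `Q` is the largest quotient of these by `h`.
  d Q k : ℕ
  d = h ∸ c
  Q = δ′ / h
  k = d + Q

  0<d : 0 < d
  0<d = ℕ.m<n⇒0<n∸m c<h

  instance
    k≢0 : NonZero k
    k≢0 = >-nonZero (ℕ.≤-trans 0<d (ℕ.m≤m+n d Q))

  class : Fin N → Fin h
  class i = toℕ i mod h

  toℕ-class : ∀ i → toℕ (class i) ≡ toℕ i % h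
  toℕ-class i = Fin.toℕ-fromℕ< (m%n<n (toℕ i) h)

  near? : (i j : Fin N) → Dec (i ≢ j × c ≤ toℕ (class i ⊕ class j))
  near? i j = ¬? (i Fin.≟ j) ×-dec (c ℕ.≤? toℕ (class i ⊕ class j))

  star? : (i : Fin N) → Dec (toℕ i < suc δ′)
  star? i = toℕ i ℕ.<? suc δ′

  near-sym : ∀ {i j} → i ≢ j × c ≤ toℕ (class i ⊕ class j) → j ≢ i × c ≤ toℕ (class j ⊕ class i)
  near-sym {i} {j} (i≢j , c≤) = i≢j ∘ sym , subst (λ e → c ≤ toℕ e) (⊕-comm (class i) (class j)) c≤

  G : Graph (suc N)
  G = record { adj = α ; adj-sym = α-sym ; adj-irrefl = α-irrefl }
    where
    α : Fin (suc N) → Fin (suc N) → Bool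
    α zero    zero    = false
    α zero    (suc j) = does (star? j)
    α (suc i) zero    = does (star? i)
    α (suc i) (suc j) = does (near? i j)
    α-sym : ∀ u v → α u v ≡ α v u
    α-sym zero    zero    = refl
    α-sym zero    (suc j) = refl
    α-sym (suc i) zero    = refl
    α-sym (suc i) (suc j) = does-⇔ (mk⇔ near-sym near-sym) (near? i j) (near? j i)
    α-irrefl : ∀ v → α v v ≡ false
    α-irrefl zero    = refl
    α-irrefl (suc i) = dec-false (near? i i) (λ (i≢i , _) → i≢i refl)

  -- Neighbours of the special vertex in one class have different quotients by `h`, hence different
  -- labels. Quotient 0 reuses colour 0, so that `d + Q` colours suffice.
  label : ℕ → ℕ
  label zero    = 0
  label (suc t) = d + t

  κ : Fin (suc N) → Fin (suc N) → ℕ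
  κ zero    zero    = 0
  κ zero    (suc j) = label (toℕ j / h)
  κ (suc i) zero    = label (toℕ i / h)
  κ (suc i) (suc j) = toℕ (class i ⊕ class j) ∸ c

  κ-sym : ∀ u v → κ u v ≡ κ v u
  κ-sym zero    zero    = refl
  κ-sym zero    (suc j) = refl
  κ-sym (suc i) zero    = refl
  κ-sym (suc i) (suc j) = cong (λ e → toℕ e ∸ c) (⊕-comm (class i) (class j))

  χ : EdgeColouring G k
  χ = colouring G κ κ-sym

  label< : ∀ {t} → t ≤ Q → label t < k
  label< {zero}  _  = ℕ.≤-trans 0<d (ℕ.m≤m+n d Q)
  label< {suc t} t< = ℕ.+-monoʳ-< d t<

  toℕ-colour-star : ∀ {i} → toℕ i < suc δ′ → toℕ (colour χ zero (suc i)) ≡ label (toℕ i / h)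
  toℕ-colour-star {i} (s≤s i≤) = toℕ-colour G κ κ-sym {zero} {suc i} (label< (/-monoˡ-≤ h i≤))

  toℕ-colour-near : ∀ {i j} → c ≤ toℕ (class i ⊕ class j) →
                    toℕ (colour χ (suc i) (suc j)) < d × toℕ (colour χ (suc i) (suc j)) + c ≡ toℕ (class i ⊕ class j)
  toℕ-colour-near {i} {j} c≤ =
    subst (_< d) (sym eq) below , trans (cong (_+ c) eq) (ℕ.m∸n+n≡m c≤)
    where
    below : κ (suc i) (suc j) < d
    below = ℕ.∸-monoˡ-< (Fin.toℕ<n (class i ⊕ class j)) c≤
    eq : toℕ (colour χ (suc i) (suc j)) ≡ κ (suc i) (suc j)
    eq = toℕ-colour G κ κ-sym {suc i} {suc j} (ℕ.≤-trans below (ℕ.m≤m+n d Q))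

  -- The group element carried by a colour; the d-th and later colours, used at
  -- the special vertex only, carry the same element as colour 0.
  element : Fin k → Fin h
  element x with toℕ x ℕ.<? d
  ... | yes _ = (toℕ x + c) mod h
  ... | no  _ = c mod h

  mod-toℕ : ∀ (e : Fin h) → toℕ e mod h ≡ e
  mod-toℕ e = Fin.toℕ-injective (trans (Fin.toℕ-fromℕ< (m%n<n (toℕ e) h)) (m<n⇒m%n≡m (Fin.toℕ<n e)))

  element-near : ∀ {i j} → c ≤ toℕ (class i ⊕ class j) → element (colour χ (suc i) (suc j)) ≡ class i ⊕ class j
  element-near {i} {j} c≤ with toℕ (colour χ (suc i) (suc j)) ℕ.<? d | toℕ-colour-near {i} {j} c≤
  ... | yes _ | _ , eq = trans (cong (_mod h) eq) (mod-toℕ _)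
  ... | no ¬p | p , _  = contradiction p ¬p

  element-star : ∀ {i} → toℕ i < suc δ′ → element (colour χ zero (suc i)) ≡ c mod h
  element-star {i} i< with toℕ (colour χ zero (suc i)) ℕ.<? d | toℕ-colour-star {i} i<
  ... | no  _ | _  = refl
  ... | yes p | eq with toℕ i / h
  ... | zero  = cong (λ x → (x + c) mod h) eq
  ... | suc t = contradiction (subst (_< d) eq p) (ℕ.≤⇒≯ (ℕ.m≤m+n d t))

  -- The tests are the coordinates of `element`, whose potential away from the special vertex is the
  -- class. Both star edges carry the same element, which cancels.
  cherry-class : ∀ {i j} → toℕ i < suc δ′ → toℕ j < suc δ′ → Cherry χ zero (suc i) (suc j) → class i ≡ class j
  cherry-class {i} {j} i< j< ch = ext λ t →
    xor-cancelˡ (coord t (c mod h)) (trans (cong (λ e → coord t e xor coord t (class i)) (sym (element-star {i} i<)))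
      (trans (ch (coord t ∘ element) (φ t) (λ {a} {b} → hyp t {a} {b}))
        (cong (λ e → coord t e xor coord t (class j)) (element-star {j} j<))))
    where
    φ : Fin dim → Fin (suc N) → Bool
    φ t zero    = false
    φ t (suc i) = coord t (class i)
    hyp : ∀ t {a b} → a ≢ zero → b ≢ zero → T (adj G a b) → coord t (element (colour χ a b)) ≡ φ t a xor φ t b
    hyp t {zero}  {b}     a≢0 b≢0 _ = contradiction refl a≢0
    hyp t {suc i} {zero}  a≢0 b≢0 _ = contradiction refl b≢0
    hyp t {suc i} {suc j} _   _   e = trans (cong (coord t) (element-near {i} {j} (proj₂ (T-does (near? i j) e))))
                                            (coord-⊕ t (class i) (class j))

  -- Colour `d + t` occurs only at the special vertex, so its indicator is a test with potential
  -- zero, and the other star edge must have this colour as well.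
  cherry-quotient : ∀ {i j t} → toℕ i < suc δ′ → toℕ j < suc δ′ → Cherry χ zero (suc i) (suc j) →
                    toℕ i / h ≡ suc t → toℕ j / h ≡ suc t
  cherry-quotient {i} {j} {t} i< j< ch eq = from-label (T-does (toℕ (colour χ zero (suc j)) ℕ.≟ d + t)
      (subst T (trans (sym (xor-identityʳ _)) (trans (ch F (λ _ → false) (λ {a} {b} → hyp {a} {b})) (xor-identityʳ _)))
        (does-T (toℕ (colour χ zero (suc i)) ℕ.≟ d + t) (trans (toℕ-colour-star {i} i<) (cong label eq)))))
    where
    F : Fin k → Bool
    F x = does (toℕ x ℕ.≟ d + t)
    hyp : ∀ {a b} → a ≢ zero → b ≢ zero → T (adj G a b) → F (colour χ a b) ≡ false
    hyp {zero}  {b}     a≢0 b≢0 _ = contradiction refl a≢0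
    hyp {suc i} {zero}  a≢0 b≢0 _ = contradiction refl b≢0
    hyp {suc i} {suc j} _   _   e = dec-false (toℕ (colour χ (suc i) (suc j)) ℕ.≟ d + t) (λ eq →
      ℕ.<⇒≱ (proj₁ (toℕ-colour-near {i} {j} (proj₂ (T-does (near? i j) e)))) (subst (d ≤_) (sym eq) (ℕ.m≤m+n d t)))
    from-label : toℕ (colour χ zero (suc j)) ≡ d + t → toℕ j / h ≡ suc t
    from-label eq′ with toℕ j / h | trans (sym (toℕ-colour-star {j} j<)) eq′
    ... | zero   | eq″ = contradiction (subst (0 <_) (ℕ.m+n≡0⇒m≡0 d (sym eq″)) 0<d) λ ()
    ... | suc t′ | eq″ = cong suc (ℕ.+-cancelˡ-≡ d t′ t eq″)

  cherry-flip : ∀ {v x y} → Cherry χ v x y → Cherry χ v y x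
  cherry-flip ch F φ hyp = sym (ch F φ hyp)

  odd : (3≤n : 3 ≤ suc N) → OddColouring (cycle (suc N) 3≤n) χ
  odd 3≤n = oddColouring 3≤n χ zero λ w even → case cherry χ 3≤n w even of λ where
      (zero  , y , x≢y , () , _)
      (suc i , zero , x≢y , _ , () , _)
      (suc i , suc j , x≢y , vi , vj , ch) →
        let i< = T-does (star? i) vi
            j< = T-does (star? j) vj
            quotients : toℕ i / h ≡ toℕ j / h
            -- Colour 0 also occurs away from the special vertex, so quotient 0 is settled by
            -- exclusion: if either quotient is positive, the other equals it.
            quotients = same (toℕ i / h) (toℕ j / h) refl refl
              (cherry-quotient {i} {j} i< j< ch) (cherry-quotient {j} {i} j< i< (cherry-flip ch))
            remainders = trans (sym (toℕ-class i)) (trans (cong toℕ (cherry-class {i} {j} i< j< ch)) (toℕ-class j))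
        in x≢y (cong suc (Fin.toℕ-injective (divMod-injective (toℕ i) (toℕ j) h remainders quotients)))
    where
    same : ∀ {a b} p q → a ≡ p → b ≡ q → (∀ {t} → a ≡ suc t → b ≡ suc t) → (∀ {t} → b ≡ suc t → a ≡ suc t) → a ≡ b
    same zero    zero    refl refl f g = refl
    same zero    (suc q) refl refl f g = g refl
    same (suc p) q       refl refl f g = sym (f refl)

  private
    Nbrs : Fin (suc N) → Set
    Nbrs v = Σ[ e ∈ (Fin (suc δ′) → Fin (suc N)) ] Injective _≡_ _≡_ e × (∀ j → T (adj G v (e j)))

    leaf : Fin (suc δ′) → Fin N
    leaf j = inject≤ j δ≤N

    leaf-star : ∀ j → toℕ (leaf j) < suc δ′
    leaf-star j = subst (_< suc δ′) (sym (Fin.toℕ-inject≤ j δ≤N)) (Fin.toℕ<n j)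

    leaf-injective : Injective _≡_ _≡_ leaf
    leaf-injective {i} {j} eq = Fin.toℕ-injective (trans (sym (Fin.toℕ-inject≤ i δ≤N)) (trans (cong toℕ eq) (Fin.toℕ-inject≤ j δ≤N)))

    nbrs-special : Nbrs zero
    nbrs-special = suc ∘ leaf , (λ eq → leaf-injective (Fin.suc-injective eq)) , λ j → does-T (star? (leaf j)) (leaf-star j)

    -- The first `suc δ′` vertices after the special one serve as neighbours. If `suc i` itself is
    -- among them, it is adjacent to the special vertex, which takes its place.
    nbrs-complete : c ≡ 0 → ∀ i → Nbrs (suc i)
    nbrs-complete c≡0 i = (λ j → e (leaf j)) ,
      (λ {j} {j′} eq → leaf-injective (e-injective (leaf j) (leaf j′) eq)) ,
      λ j → e-adj (leaf j) (leaf-star j)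
      where
      e : Fin N → Fin (suc N)
      e j with i Fin.≟ j
      ... | yes _ = zero
      ... | no  _ = suc j
      e-injective : ∀ j j′ → e j ≡ e j′ → j ≡ j′
      e-injective j j′ eq with i Fin.≟ j | i Fin.≟ j′
      e-injective j j′ eq   | yes p | yes q = trans (sym p) q
      e-injective j j′ refl | no  p | no  q = refl
      e-adj : ∀ j → toℕ j < suc δ′ → T (adj G (suc i) (e j))
      e-adj j j< with i Fin.≟ j
      ... | yes refl = does-T (star? i) j<
      ... | no i≢j   = does-T (near? i j) (i≢j , subst (_≤ toℕ (class i ⊕ class j)) (sym c≡0) z≤n)

    -- Every full row of `h` consecutive vertices meets each class once. A row and an element of D
    -- therefore determine one neighbour, which gives `(N / h) * d` of them.
    nbrs-sparse : 1 ≤ c → suc δ′ ≤ (N / h) * d → ∀ i → Nbrs (suc i)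
    nbrs-sparse 1≤c enough i = (λ j → e (row j) (shift j)) , inj , hit
      where
      p = N / h
      rq : Fin (suc δ′) → Fin p × Fin d
      rq j = remQuot d (inject≤ j enough)
      row : Fin (suc δ′) → Fin p
      row = proj₁ ∘ rq
      diff : Fin d → Fin h
      diff b = fromℕ< {c + toℕ b} (ℕ.<-≤-trans (ℕ.+-monoʳ-< c (Fin.toℕ<n b)) (ℕ.≤-reflexive (ℕ.m+[n∸m]≡n (ℕ.<⇒≤ c<h))))
      shift : Fin (suc δ′) → Fin h
      shift j = class i ⊕ diff (proj₂ (rq j))
      pos< : ∀ (a : Fin p) (g : Fin h) → toℕ g + toℕ a * h < N
      pos< a g = ℕ.<-≤-trans (ℕ.+-monoˡ-< (toℕ a * h) (Fin.toℕ<n g))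
        (ℕ.≤-trans (ℕ.*-monoˡ-≤ h (Fin.toℕ<n a)) (m/n*n≤m N h))
      place : Fin p → Fin h → Fin N
      place a g = fromℕ< (pos< a g)
      e : Fin p → Fin h → Fin (suc N)
      e a g = suc (place a g)
      toℕ-place : ∀ a g → toℕ (place a g) ≡ toℕ g + toℕ a * h
      toℕ-place a g = Fin.toℕ-fromℕ< (pos< a g)
      class-place : ∀ a g → class (place a g) ≡ g
      class-place a g = Fin.toℕ-injective (begin
        toℕ (class (place a g))     ≡⟨ toℕ-class (place a g) ⟩
        toℕ (place a g) % h         ≡⟨ cong (_% h) (toℕ-place a g) ⟩
        (toℕ g + toℕ a * h) % h     ≡⟨ [m+kn]%n≡m%n (toℕ g) (toℕ a) h ⟩
        toℕ g % h                   ≡⟨ m<n⇒m%n≡m (Fin.toℕ<n g) ⟩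
        toℕ g                       ∎)
        where open ≡-Reasoning
      inj : Injective _≡_ _≡_ (λ j → e (row j) (shift j))
      inj {j} {j′} eq = Fin.toℕ-injective (trans (sym (Fin.toℕ-inject≤ j enough)) (trans (cong toℕ rq-inj) (Fin.toℕ-inject≤ j′ enough)))
        where
        open ≡-Reasoning
        same-place : place (row j) (shift j) ≡ place (row j′) (shift j′)
        same-place = Fin.suc-injective eq
        same-shift : shift j ≡ shift j′
        same-shift = trans (sym (class-place (row j) (shift j))) (trans (cong class same-place) (class-place (row j′) (shift j′)))
        same-row : row j ≡ row j′
        same-row = Fin.toℕ-injective (ℕ.*-cancelʳ-≡ _ _ h (ℕ.+-cancelˡ-≡ (toℕ (shift j)) _ _ (begin
          toℕ (shift j) + toℕ (row j) * h      ≡⟨ sym (toℕ-place (row j) (shift j)) ⟩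
          toℕ (place (row j) (shift j))        ≡⟨ cong toℕ same-place ⟩
          toℕ (place (row j′) (shift j′))      ≡⟨ toℕ-place (row j′) (shift j′) ⟩
          toℕ (shift j′) + toℕ (row j′) * h    ≡⟨ cong (λ g → toℕ g + toℕ (row j′) * h) (sym same-shift) ⟩
          toℕ (shift j) + toℕ (row j′) * h     ∎)))
        same-diff : diff (proj₂ (rq j)) ≡ diff (proj₂ (rq j′))
        same-diff = trans (sym (⊕-cancel (class i) _)) (trans (cong (class i ⊕_) same-shift) (⊕-cancel (class i) _))
        same-index : proj₂ (rq j) ≡ proj₂ (rq j′)
        same-index = Fin.toℕ-injective (ℕ.+-cancelˡ-≡ c _ _ (trans (sym (Fin.toℕ-fromℕ< _)) (trans (cong toℕ same-diff) (Fin.toℕ-fromℕ< _))))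
        rq-inj : inject≤ j enough ≡ inject≤ j′ enough
        rq-inj = begin
          inject≤ j enough             ≡⟨ sym (Fin.combine-remQuot {p} d _) ⟩
          uncurry combine (rq j)       ≡⟨ cong₂ combine same-row same-index ⟩
          uncurry combine (rq j′)      ≡⟨ Fin.combine-remQuot {p} d _ ⟩
          inject≤ j′ enough            ∎
      hit : ∀ j → T (adj G (suc i) (e (row j) (shift j)))
      hit j = does-T (near? i (place (row j) (shift j))) (apart , subst (λ x → c ≤ toℕ x) (sym difference) c≤diff)
        where
        difference : class i ⊕ class (place (row j) (shift j)) ≡ diff (proj₂ (rq j))
        difference = trans (cong (class i ⊕_) (class-place (row j) (shift j))) (⊕-cancel (class i) _)
        c≤diff : c ≤ toℕ (diff (proj₂ (rq j)))
        c≤diff = subst (c ≤_) (sym (Fin.toℕ-fromℕ< _)) (ℕ.m≤m+n c _)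
        -- Within the class of `i` the difference is 0, but here it is at least `c ≥ 1`.
        apart : i ≢ place (row j) (shift j)
        apart eq = ℕ.<⇒≱ (ℕ.≤-trans 1≤c c≤diff) (ℕ.≤-reflexive
          (trans (cong toℕ (trans (sym difference) (cong (λ x → class i ⊕ class x) (sym eq)))) (⊕-self (class i))))

  oddColourable : (3≤n : 3 ≤ suc N) → c ≡ 0 ⊎ (1 ≤ c × suc δ′ ≤ (N / h) * d) →
                  OddColourable (suc N) (suc δ′) (cycle (suc N) 3≤n) k
  oddColourable 3≤n dense = >-nonZero⁻¹ k , G , δ≤minDegree G (ℕ.m≤n⇒m≤1+n δ≤N) nbrs , χ , odd 3≤n
    where
    nbrs : ∀ v → Nbrs v
    nbrs zero    = nbrs-special
    nbrs (suc i) = [ (λ c≡0 → nbrs-complete c≡0 i) , (λ (1≤c , enough) → nbrs-sparse 1≤c enough i) ]′ dense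

-- Two cliques

unique-middle : ∀ {A : Set} (l : List A) {x r} → Unique (l ++ x ∷ r) → x ∉ l × x ∉ r
unique-middle []      (x∉ ∷ _)  = (λ ()) , λ x∈ → All.lookup x∉ x∈ refl
unique-middle (y ∷ l) (y∉ ∷ u) with unique-middle l u
... | x∉l , x∉r = (λ { (here refl) → All.lookup y∉ (∈-++⁺ʳ l (here refl)) refl ; (there x∈) → x∉l x∈ }) , x∉r

-- Used to turn a clique of `suc k` vertices into `k` neighbours of `v`: `v` is removed, or the
-- first vertex if `v` does not occur.
open-neighbourhood : ∀ {n k} {v : Fin n} (e : Fin (suc k) → Fin n) → Injective _≡_ _≡_ e →
  Σ[ e′ ∈ (Fin k → Fin n) ] Injective _≡_ _≡_ e′ × (∀ j → v ≢ e′ j × ∃[ i ] e′ j ≡ e i)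
open-neighbourhood {v = v} e inj with Fin.any? (λ j → v Fin.≟ e j)
... | yes (j₀ , eq₀) = e ∘ punchIn j₀ , (λ {i} {j} eq → Fin.punchIn-injective j₀ i j (inj eq)) ,
  λ j → (λ eq → Fin.punchInᵢ≢i j₀ j (inj (trans (sym eq) eq₀))) , _ , refl
... | no miss = e ∘ suc , (λ eq → Fin.suc-injective (inj eq)) , λ j → (λ eq → miss (suc j , eq)) , suc j , refl

-- The cliques are S ∪ A and S ∪ B, where S, A and B are consecutive blocks of
-- s, a and a vertices.
module TwoCliques (m s a : ℕ) (n≡ : suc m ≡ s + a + a) (0<s : 0 < s) (0<a : 0 < a) where

  InA InB : Fin (suc m) → Set
  InA u = s ≤ toℕ u × toℕ u < s + a
  InB u = s + a ≤ toℕ u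

  abstract
    inS? : ∀ t → Dec (t < s)
    inS? t = t ℕ.<? s

    inA? : ∀ u → Dec (InA u)
    inA? u = (s ℕ.≤? toℕ u) ×-dec (toℕ u ℕ.<? s + a)

    inB? : ∀ u → Dec (InB u)
    inB? u = s + a ℕ.≤? toℕ u

  Cross : Fin (suc m) → Fin (suc m) → Set
  Cross u v = InA u × InB v

  linked? : ∀ u v → Dec (u ≢ v × ¬ Cross u v × ¬ Cross v u)
  linked? u v = ¬? (u Fin.≟ v) ×-dec ¬? (inA? u ×-dec inB? v) ×-dec ¬? (inA? v ×-dec inB? u)

  linked-sym : ∀ u v → does (linked? u v) ≡ does (linked? v u)
  linked-sym u v = does-⇔ (mk⇔ flip flip) (linked? u v) (linked? v u)
    where
    flip : ∀ {u v} → u ≢ v × ¬ Cross u v × ¬ Cross v u → v ≢ u × ¬ Cross v u × ¬ Cross u v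
    flip (u≢v , p , q) = u≢v ∘ sym , q , p

  G : Graph (suc m)
  G = record
    { adj        = λ u v → does (linked? u v)
    ; adj-sym    = linked-sym
    ; adj-irrefl = λ v → dec-false (linked? v v) (λ (v≢v , _) → v≢v refl)
    }

  mark : Fin (suc m) → ℕ
  mark u = if does (inS? (toℕ u)) then toℕ u else 0

  κ : Fin (suc m) → Fin (suc m) → ℕ
  κ u v = if does (inA? v) then mark u else (if does (inA? u) then mark v else 0)

  A⇒unmarked : ∀ {u} → InA u → mark u ≡ 0
  A⇒unmarked {u} (s≤u , _) rewrite dec-false (inS? (toℕ u)) (ℕ.≤⇒≯ s≤u) = refl

  κ-sym : ∀ u v → κ u v ≡ κ v u
  κ-sym u v with inA? u | inA? v
  ... | yes p | yes q = trans (A⇒unmarked {u} p) (sym (A⇒unmarked {v} q))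
  ... | yes _ | no _  = refl
  ... | no _  | yes _ = refl
  ... | no _  | no _  = refl

  mark-cases : ∀ u → mark u ≡ 0 ⊎ (toℕ u < s × mark u ≡ toℕ u)
  mark-cases u with inS? (toℕ u)
  ... | yes p = inj₂ (p , refl)
  ... | no  _ = inj₁ refl

  -- A positive colour names one of the endpoints: colour `i` is seen only at x_i, so the vertices
  -- of S can be tested one at a time.
  κ-cases : ∀ u v → κ u v ≡ 0 ⊎ (κ u v ≡ toℕ u × toℕ u < s) ⊎ (κ u v ≡ toℕ v × toℕ v < s)
  κ-cases u v with inA? v | inA? u
  ... | yes _ | _ = [ inj₁ , (λ (p , eq) → inj₂ (inj₁ (eq , p))) ]′ (mark-cases u)
  ... | no _  | yes _ = [ inj₁ , (λ (p , eq) → inj₂ (inj₂ (eq , p))) ]′ (mark-cases v)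
  ... | no _  | no _  = inj₁ refl

  κ<s : ∀ u v → κ u v < s
  κ<s u v with κ-cases u v
  ... | inj₁ eq              = subst (_< s) (sym eq) 0<s
  ... | inj₂ (inj₁ (eq , p)) = subst (_< s) (sym eq) p
  ... | inj₂ (inj₂ (eq , p)) = subst (_< s) (sym eq) p

  instance
    s≢0 : NonZero s
    s≢0 = >-nonZero 0<s

  χ : EdgeColouring G s
  χ = colouring G κ κ-sym

  toℕ-χ : ∀ u v → toℕ (colour χ u v) ≡ κ u v
  toℕ-χ u v = toℕ-colour G κ κ-sym {u} {v} (κ<s u v)

  hasColour : Fin (suc m) → Fin s → Bool
  hasColour x c = does (toℕ c ℕ.≟ toℕ x)

  hasColour-away : ∀ {x u v} → x ≢ zero → x ≢ u → x ≢ v → hasColour x (colour χ u v) ≡ false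
  hasColour-away {x} {u} {v} x≢0 x≢u x≢v = dec-false (toℕ (colour χ u v) ℕ.≟ toℕ x) λ eq →
    case κ-cases u v of λ where
      (inj₁ eq′) → x≢0 (Fin.toℕ-injective (trans (sym eq) (trans (toℕ-χ u v) eq′)))
      (inj₂ (inj₁ (eq′ , _))) → x≢u (Fin.toℕ-injective (trans (sym eq) (trans (toℕ-χ u v) eq′)))
      (inj₂ (inj₂ (eq′ , _))) → x≢v (Fin.toℕ-injective (trans (sym eq) (trans (toℕ-χ u v) eq′)))

  hasColour-at : ∀ {x y} → x ≢ zero → toℕ x < s → hasColour x (colour χ x y) ≡ does (inA? y)
  hasColour-at {x} {y} x≢0 x<s rewrite toℕ-χ x y with inA? y
  ... | yes _ rewrite dec-true (inS? (toℕ x)) x<s = dec-true (toℕ x ℕ.≟ toℕ x) refl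
  ... | no _  rewrite dec-false (inA? x) (λ (s≤x , _) → ℕ.<⇒≱ x<s s≤x) =
    dec-false (0 ℕ.≟ toℕ x) (λ eq → x≢0 (Fin.toℕ-injective (sym eq)))

  module _ {count} (w : HamiltonWalk χ zero count) (even : AllEven (HamiltonWalk.walkColours w)) where

    open HamiltonWalk w

    -- Colour `toℕ x` can occur only on the two cycle edges at `x`, where it marks the neighbours in
    -- A; an even count makes both neighbours agree.
    balanced : ∀ l u x y r → zero ∷ rest ≡ l ++ u ∷ x ∷ y ∷ r →
               T (adj G x y) × (toℕ x < s → does (inA? u) ≡ does (inA? y))
    balanced l u x y r eq = xy , λ x<s → xor-false⇒≡ (begin
        does (inA? u) xor does (inA? y)
          ≡⟨ cong₂ _xor_ (sym (trans (cong (hasColour x) (colour-sym χ u x)) (hasColour-at x≢0 x<s))) (sym (hasColour-at x≢0 x<s)) ⟩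
        F (u , x) xor F (x , y)
          ≡⟨ cong (F (u , x) xor_) (sym (trans (cong (F (x , y) xor_) after) (xor-identityʳ _))) ⟩
        xorSum F ((u , x) ∷ (x , y) ∷ steps (y ∷ r ++ zero ∷ []))
          ≡⟨ cong (_xor xorSum F ((u , x) ∷ (x , y) ∷ steps (y ∷ r ++ zero ∷ []))) (sym before) ⟩
        xorSum F (steps (l ++ u ∷ [])) xor xorSum F ((u , x) ∷ (x , y) ∷ steps (y ∷ r ++ zero ∷ []))
          ≡⟨ sym (xorSum-++ F (steps (l ++ u ∷ [])) _) ⟩
        xorSum F (steps (l ++ u ∷ []) ++ (u , x) ∷ (x , y) ∷ steps (y ∷ r ++ zero ∷ []))
          ≡⟨ cong (xorSum F) (sym shape) ⟩
        xorSum F (steps (zero ∷ rest ++ zero ∷ []))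
          ≡⟨ sym (xorSum-map (hasColour x) (uncurry (colour χ)) (steps (zero ∷ rest ++ zero ∷ []))) ⟩
        xorSum (hasColour x) walkColours
          ≡⟨ AllEven⇒xorSum-false {cs = walkColours} even (hasColour x) ⟩
        false ∎)
      where
      open ≡-Reasoning
      F : Fin (suc m) × Fin (suc m) → Bool
      F = hasColour x ∘ uncurry (colour χ)
      shape : steps (zero ∷ rest ++ zero ∷ []) ≡
              steps (l ++ u ∷ []) ++ (u , x) ∷ (x , y) ∷ steps (y ∷ r ++ zero ∷ [])
      shape = trans (cong (λ z → steps (z ++ zero ∷ [])) eq)
                (trans (cong steps (++-assoc l (u ∷ x ∷ y ∷ r) (zero ∷ []))) (steps-++ l u (x ∷ y ∷ r ++ zero ∷ [])))
      xy : T (adj G x y)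
      xy = All.head (All.tail (All.++⁻ʳ (steps (l ++ u ∷ [])) (subst (All _) shape adjacent)))
      uniq : Unique ((l ++ u ∷ []) ++ x ∷ y ∷ r)
      uniq = subst Unique (trans eq (sym (++-assoc l (u ∷ []) (x ∷ y ∷ r)))) distinct
      x∉ˡ : x ∉ l ++ u ∷ []
      x∉ˡ = proj₁ (unique-middle (l ++ u ∷ []) uniq)
      -- The walk starts at x₀, so `x`, which has a predecessor `u`, is another vertex and its index
      -- is positive.
      x≢0 : x ≢ zero
      x≢0 = head≢ l eq x∉ˡ
        where
        head≢ : ∀ l → zero ∷ rest ≡ l ++ u ∷ x ∷ y ∷ r → x ∉ l ++ u ∷ [] → x ≢ zero
        head≢ []      refl x∉ x≡ = x∉ (here x≡)
        head≢ (_ ∷ _) refl x∉ x≡ = x∉ (here x≡)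
      x∉ʳ : x ∉ y ∷ r ++ zero ∷ []
      x∉ʳ x∈ with ∈-++⁻ (y ∷ r) x∈
      ... | inj₁ x∈′        = proj₂ (unique-middle (l ++ u ∷ []) uniq) x∈′
      ... | inj₂ (here x≡0) = x≢0 x≡0
      vanish : ∀ zs → x ∉ zs → xorSum F (steps zs) ≡ false
      vanish zs x∉ = xorSum-false F (All.tabulate λ {e} e∈ →
        let p , q = ∈-steps zs e∈ in
        hasColour-away {x} {proj₁ e} {proj₂ e} x≢0 (λ { refl → x∉ p }) (λ { refl → x∉ q }))
      before : xorSum F (steps (l ++ u ∷ [])) ≡ false
      before = vanish (l ++ u ∷ []) x∉ˡ
      after : xorSum F (steps (y ∷ r ++ zero ∷ [])) ≡ false
      after = vanish (y ∷ r ++ zero ∷ []) x∉ʳ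

    -- The invariant of a walk that has entered A: it is in A, or it stands in S after a step from
    -- A.
    Trapped : Fin (suc m) → Fin (suc m) → Set
    Trapped u x = InA x ⊎ (toℕ x < s × InA u)

    private
      extend : ∀ l u {x y r} → zero ∷ rest ≡ l ++ u ∷ x ∷ y ∷ r → zero ∷ rest ≡ (l ++ u ∷ []) ++ x ∷ y ∷ r
      extend l u eq = trans eq (sym (++-assoc l (u ∷ []) _))

      transfer : ∀ {P Q : Set} {P? : Dec P} {Q? : Dec Q} → does P? ≡ does Q? → P → Q
      transfer {P? = P?} {Q?} eq p = T-does Q? (subst T eq (does-T P? p))

    -- From A the walk can step only to A or S, since A and B are not joined; from S it returns to A
    -- because the two neighbours agree.
    avoidB : ∀ l u x r → zero ∷ rest ≡ l ++ u ∷ x ∷ r → Trapped u x → All (¬_ ∘ InB) (x ∷ r)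
    avoidB l u x r eq t = notB t ∷ rest′ r eq
      where
      notB : ∀ {u x} → Trapped u x → ¬ InB x
      notB (inj₁ (_ , x<)) x≥ = ℕ.<⇒≱ x< x≥
      notB (inj₂ (x<s , _)) x≥ = ℕ.<⇒≱ x<s (ℕ.≤-trans (ℕ.m≤m+n s a) x≥)
      rest′ : ∀ r → zero ∷ rest ≡ l ++ u ∷ x ∷ r → All (¬_ ∘ InB) r
      rest′ []      _  = []
      rest′ (y ∷ r) eq = avoidB (l ++ u ∷ []) x y r (extend l u eq) (next t)
        where
        bal = balanced l u x y r eq
        next : Trapped u x → Trapped x y
        next (inj₂ (x<s , Au)) = inj₁ (transfer {P? = inA? u} {inA? y} (proj₂ bal x<s) Au)
        next (inj₁ Ax) with toℕ y ℕ.<? s | toℕ y ℕ.<? s + a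
        ... | yes y<s | _       = inj₂ (y<s , Ax)
        ... | no y≮s  | yes y<  = inj₁ (ℕ.≮⇒≥ y≮s , y<)
        ... | no y≮s  | no y≮   = contradiction (Ax , ℕ.≮⇒≥ y≮) (proj₁ (proj₂ (T-does (linked? x y) (proj₁ bal))))

    -- The invariant is that two consecutive vertices lie outside A. From S the walk stays outside A
    -- because the neighbours agree, from B because no edge leads to A.
    avoidA : ∀ l u x r → zero ∷ rest ≡ l ++ u ∷ x ∷ r → ¬ InA u → ¬ InA x → All (¬_ ∘ InA) (x ∷ r)
    avoidA l u x []      eq ¬Au ¬Ax = ¬Ax ∷ []
    avoidA l u x (y ∷ r) eq ¬Au ¬Ax = ¬Ax ∷ avoidA (l ++ u ∷ []) x y r (extend l u eq) ¬Ax ¬Ay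
      where
      bal = balanced l u x y r eq
      ¬Ay : ¬ InA y
      ¬Ay Ay with toℕ x ℕ.<? s | toℕ x ℕ.<? s + a
      ... | yes x<s | _      = ¬Au (transfer {P? = inA? y} {inA? u} (sym (proj₂ bal x<s)) Ay)
      ... | no x≮s  | yes x< = ¬Ax (ℕ.≮⇒≥ x≮s , x<)
      ... | no x≮s  | no x≮  = proj₂ (proj₂ (T-does (linked? x y) (proj₁ bal))) (Ay , ℕ.≮⇒≥ x≮)

    private
      vertexAt : ∀ t → t < s + a + a → Fin (suc m)
      vertexAt t t< = fromℕ< {t} (subst (t <_) (sym n≡) t<)

      visited : ∀ t (t< : t < s + a + a) → 0 < t → vertexAt t t< ∈ rest
      visited t t< 0<t with covers (vertexAt t t<)
      ... | there v∈ = v∈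
      ... | here eq  = contradiction (trans (sym (Fin.toℕ-fromℕ< _)) (cong toℕ eq)) (ℕ.m<n⇒n≢0 0<t)

      A-visited : ∃[ u ] u ∈ rest × InA u
      A-visited = vertexAt s s<n , visited s s<n 0<s , ℕ.≤-reflexive (sym (Fin.toℕ-fromℕ< _)) ,
                  subst (_< s + a) (sym (Fin.toℕ-fromℕ< _)) s<s+a
        where
        s<s+a = ℕ.m<m+n s 0<a
        s<n = ℕ.<-≤-trans s<s+a (ℕ.m≤m+n (s + a) a)

      B-visited : ∃[ u ] u ∈ rest × InB u
      B-visited = vertexAt (s + a) lt , visited (s + a) lt (ℕ.≤-trans 0<s (ℕ.m≤m+n s a)) , ℕ.≤-reflexive (sym (Fin.toℕ-fromℕ< _))
        where
        lt = ℕ.m<m+n (s + a) 0<a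

    -- The first vertex after x₀ decides which private part the walk misses, yet both parts are
    -- nonempty and every vertex is visited.
    uneven : ⊥
    uneven = start rest refl
      where
      start : ∀ zs → rest ≡ zs → ⊥
      start [] eq with A-visited
      ... | u , u∈ , _ rewrite eq = case u∈ of λ ()
      start (x ∷ r) eq with inA? x
      ... | yes Ax = let u , u∈ , Bu = B-visited in
        All.lookup (avoidB [] zero x r (cong (zero ∷_) eq) (inj₁ Ax)) (subst (u ∈_) eq u∈) Bu
      ... | no ¬Ax = let u , u∈ , Au = A-visited in
        All.lookup (avoidA [] zero x r (cong (zero ∷_) eq) (λ (s≤0 , _) → ℕ.<⇒≱ 0<s s≤0) ¬Ax) (subst (u ∈_) eq u∈) Au

  module _ {δ} (1+δ≡ : suc δ ≡ s + a) where

    private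
      <n : ∀ {t} → t < s + a + a → t < suc m
      <n {t} = subst (t <_) (sym n≡)

      j< : ∀ (j : Fin (suc δ)) → toℕ j < s + a
      j< j = subst (toℕ j <_) 1+δ≡ (Fin.toℕ<n j)

      inClique₁ : Fin (suc δ) → Fin (suc m)
      inClique₁ j = fromℕ< (<n (ℕ.<-≤-trans (j< j) (ℕ.m≤m+n (s + a) a)))

      toℕ-inClique₁ : ∀ j → toℕ (inClique₁ j) ≡ toℕ j
      toℕ-inClique₁ j = Fin.toℕ-fromℕ< _

      -- Enumerates S ∪ B by the numbers below `s + a`, jumping over A.
      slide : ℕ → ℕ
      slide t = if does (inS? t) then t else t + a

      slide< : ∀ {t} → t < s + a → slide t < s + a + a
      slide< {t} t< with inS? t
      ... | yes _ = ℕ.<-≤-trans t< (ℕ.m≤m+n (s + a) a)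
      ... | no  _ = ℕ.+-monoˡ-< a t<

      slide-injective : ∀ {t t′} → slide t ≡ slide t′ → t ≡ t′
      slide-injective {t} {t′} eq with inS? t | inS? t′
      ... | yes _ | yes _ = eq
      ... | yes p | no ¬q = contradiction (ℕ.≤-trans (ℕ.m≤m+n t′ a) (ℕ.≤-reflexive (sym eq))) (ℕ.<⇒≱ (ℕ.<-≤-trans p (ℕ.≮⇒≥ ¬q)))
      ... | no ¬p | yes q = contradiction (ℕ.≤-trans (ℕ.m≤m+n t a) (ℕ.≤-reflexive eq)) (ℕ.<⇒≱ (ℕ.<-≤-trans q (ℕ.≮⇒≥ ¬p)))
      ... | no _  | no _  = ℕ.+-cancelʳ-≡ a t t′ eq

      slide-¬A : ∀ {t} → ¬ (s ≤ slide t × slide t < s + a)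
      slide-¬A {t} (s≤ , <s+a) with inS? t
      ... | yes t<s = ℕ.<⇒≱ t<s s≤
      ... | no t≮s  = ℕ.<⇒≱ <s+a (ℕ.+-monoˡ-≤ a (ℕ.≮⇒≥ t≮s))

      inClique₂ : Fin (suc δ) → Fin (suc m)
      inClique₂ j = fromℕ< (<n (slide< (j< j)))

      toℕ-inClique₂ : ∀ j → toℕ (inClique₂ j) ≡ slide (toℕ j)
      toℕ-inClique₂ j = Fin.toℕ-fromℕ< _

    nbrs : ∀ v → Σ[ e ∈ (Fin δ → Fin (suc m)) ] Injective _≡_ _≡_ e × (∀ j → T (adj G v (e j)))
    nbrs v = split (inB? v)
      where
      split : Dec (InB v) → Σ[ e ∈ (Fin δ → Fin (suc m)) ] Injective _≡_ _≡_ e × (∀ j → T (adj G v (e j)))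
      split (no ¬Bv) =
        let e , inj , near = open-neighbourhood {v = v} inClique₁ λ {i} {j} eq →
              Fin.toℕ-injective (trans (sym (toℕ-inClique₁ i)) (trans (cong toℕ eq) (toℕ-inClique₁ j)))
        in e , inj , λ j → let v≢ , i , eq = near j in
          does-T (linked? v (e j)) (v≢ , (λ (_ , B) → ℕ.<⇒≱ (j< i) (ℕ.≤-trans B (ℕ.≤-reflexive (trans (cong toℕ eq) (toℕ-inClique₁ i))))) ,
            λ (_ , B) → ¬Bv B)
      split (yes Bv) =
        let e , inj , near = open-neighbourhood {v = v} inClique₂ λ {i} {j} eq →
              Fin.toℕ-injective (slide-injective (trans (sym (toℕ-inClique₂ i)) (trans (cong toℕ eq) (toℕ-inClique₂ j))))
        in e , inj , λ j → let v≢ , i , eq = near j in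
          does-T (linked? v (e j)) (v≢ , (λ ((_ , v<) , _) → ℕ.<⇒≱ v< Bv) ,
            λ (A , _) → slide-¬A {toℕ i} (subst (λ t → s ≤ t × t < s + a) (trans (cong toℕ eq) (toℕ-inClique₂ i)) A))

    oddColourable : (3≤n : 3 ≤ suc m) → OddColourable (suc m) δ (cycle (suc m) 3≤n) s
    oddColourable 3≤n = 0<s , G , δ≤minDegree G δ≤n nbrs , χ , oddColouring 3≤n χ zero uneven
      where
      δ≤n : δ ≤ suc m
      δ≤n = ℕ.≤-trans (ℕ.n≤1+n δ) (ℕ.≤-trans (ℕ.≤-reflexive 1+δ≡) (ℕ.≤-trans (ℕ.m≤m+n (s + a) a) (ℕ.≤-reflexive (sym n≡))))

-- Arithmetic of the bound

square-cancel-≤ : ∀ {m n} → m * m ≤ n * n → m ≤ n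
square-cancel-≤ {m} {n} m²≤n² with m ℕ.≤? n
... | yes m≤n = m≤n
... | no  m≰n = contradiction m²≤n² (ℕ.<⇒≱ (ℕ.*-mono-< (ℕ.≰⇒> m≰n) (ℕ.≰⇒> m≰n)))

-- The descent starts at exponent `n`, where the square is already too large, and stops at the first
-- power whose square is at most `n`.
power-between : ∀ {n} → 0 < n → ∃[ m ] 2 ^ m * 2 ^ m ≤ n × n < (2 * 2 ^ m) * (2 * 2 ^ m)
power-between {n} 0<n = descend n (ℕ.<-≤-trans (n<2^n n) (ℕ.m≤m*n (2 ^ n) (2 ^ n) {{ℕ.m^n≢0 2 n}}))
  where
  n<2^n : ∀ n → n < 2 ^ n
  n<2^n zero    = s≤s z≤n
  n<2^n (suc n) = ℕ.≤-trans (ℕ.+-mono-≤ (ℕ.m^n>0 2 n) (n<2^n n)) (ℕ.≤-reflexive (cong (λ z → 2 ^ n + z) (sym (ℕ.+-identityʳ (2 ^ n)))))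
  descend : ∀ j → n < 2 ^ j * 2 ^ j → ∃[ m ] 2 ^ m * 2 ^ m ≤ n × n < (2 * 2 ^ m) * (2 * 2 ^ m)
  descend zero    n<1 = contradiction 0<n (ℕ.<⇒≱ n<1)
  descend (suc j) n<  with 2 ^ j * 2 ^ j ℕ.≤? n
  ... | yes ≤n = j , ≤n , n<
  ... | no  ≰n = descend j (ℕ.≰⇒> ≰n)

-- The difference of the two sides is (b - a)(d - c).
rearrangement : ∀ {a b c d} → a ≤ b → c ≤ d → a * d + b * c ≤ a * c + b * d
rearrangement {a} {b} {c} {d} a≤b c≤d
  with f , refl ← ℕ.m≤n⇒∃[o]m+o≡n a≤b | e , refl ← ℕ.m≤n⇒∃[o]m+o≡n c≤d =
  ℕ.≤-trans (ℕ.m≤m+n _ (f * e)) (ℕ.≤-reflexive (solve 4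
    (λ a c f e → (a :* (c :+ e) :+ (a :+ f) :* c) :+ f :* e := a :* c :+ (a :+ f) :* (c :+ e)) refl a c f e))

-- A rearranged form of (2x - n)(2n - x) ≥ 0.
ratio-bound : ∀ {x n} → x ≤ 2 * n → n ≤ 2 * x → 2 * ((x + n) * (x + n)) ≤ 9 * (n * x)
ratio-bound {x} {n} x≤2n n≤2x = begin
  2 * ((x + n) * (x + n))
    ≡⟨ solve 2 (λ x n → con 2 :* ((x :+ n) :* (x :+ n))
         := (n :* (con 2 :* n) :+ (con 2 :* x) :* x) :+ con 4 :* (n :* x)) refl x n ⟩
  (n * (2 * n) + (2 * x) * x) + 4 * (n * x)
    ≤⟨ ℕ.+-monoˡ-≤ (4 * (n * x)) (rearrangement n≤2x x≤2n) ⟩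
  (n * x + (2 * x) * (2 * n)) + 4 * (n * x)
    ≡⟨ solve 2 (λ x n → (n :* x :+ (con 2 :* x) :* (con 2 :* n)) :+ con 4 :* (n :* x)
         := con 9 :* (n :* x)) refl x n ⟩
  9 * (n * x) ∎
  where open ℕ.≤-Reasoning

-- Here √2 ≤ P/Q and R/S ≤ √n, and the claim is the square-root bound multiplied by 2QR. After
-- multiplication by `n * h` only `scale` remains, proved by squaring and `ratio-bound` with x = h².
clear-roots : ∀ {P Q R S} n h δ k .{{_ : NonZero n}} .{{_ : NonZero h}} →
  2 * (Q * Q) ≤ P * P → R * R ≤ n * (S * S) →
  h * h ≤ 2 * n → n ≤ 2 * (h * h) →
  k * (n * h) ≤ δ * (h * h + n) + 3 * (n * h) →
  k * (2 * (Q * R)) ≤ 3 * (P * (S * δ)) + 6 * (Q * R)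
clear-roots {P} {Q} {R} {S} n h δ k √2≤ ≤√n h²≤ ≤h² k≤ =
  ℕ.*-cancelʳ-≤ _ _ (n * h) {{ℕ.m*n≢0 n h}} (begin
    k * (2 * (Q * R)) * (n * h)
      ≡⟨ solve 4 (λ k q r m → k :* (con 2 :* (q :* r)) :* m
           := k :* m :* (con 2 :* (q :* r))) refl k Q R (n * h) ⟩
    k * (n * h) * (2 * (Q * R))
      ≤⟨ ℕ.*-monoˡ-≤ (2 * (Q * R)) k≤ ⟩
    (δ * y + 3 * (n * h)) * (2 * (Q * R))
      ≡⟨ solve 5 (λ δ y m q r → (δ :* y :+ con 3 :* m) :* (con 2 :* (q :* r))
           := δ :* (con 2 :* (r :* (q :* y))) :+ con 6 :* (q :* r) :* m) refl δ y (n * h) Q R ⟩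
    δ * (2 * (R * (Q * y))) + 6 * (Q * R) * (n * h)
      ≤⟨ ℕ.+-monoˡ-≤ (6 * (Q * R) * (n * h)) (ℕ.*-monoʳ-≤ δ scale) ⟩
    δ * (3 * (P * (S * (n * h)))) + 6 * (Q * R) * (n * h)
      ≡⟨ solve 6 (λ δ p s m q r → δ :* (con 3 :* (p :* (s :* m))) :+ con 6 :* (q :* r) :* m
           := (con 3 :* (p :* (s :* δ)) :+ con 6 :* (q :* r)) :* m) refl δ P S (n * h) Q R ⟩
    (3 * (P * (S * δ)) + 6 * (Q * R)) * (n * h) ∎)
  where
  open ℕ.≤-Reasoning
  y = h * h + n
  scale : 2 * (R * (Q * y)) ≤ 3 * (P * (S * (n * h)))
  scale = square-cancel-≤ (begin
    (2 * (R * (Q * y))) * (2 * (R * (Q * y)))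
      ≡⟨ solve 3 (λ r q y → (con 2 :* (r :* (q :* y))) :* (con 2 :* (r :* (q :* y)))
           := r :* r :* (con 4 :* (q :* q :* (y :* y)))) refl R Q y ⟩
    R * R * (4 * (Q * Q * (y * y)))
      ≤⟨ ℕ.*-monoˡ-≤ _ ≤√n ⟩
    n * (S * S) * (4 * (Q * Q * (y * y)))
      ≡⟨ solve 4 (λ n s q y → n :* (s :* s) :* (con 4 :* (q :* q :* (y :* y)))
           := con 2 :* (n :* (s :* s) :* (q :* q)) :* (con 2 :* (y :* y))) refl n S Q y ⟩
    2 * (n * (S * S) * (Q * Q)) * (2 * (y * y))
      ≤⟨ ℕ.*-monoʳ-≤ (2 * (n * (S * S) * (Q * Q))) (ratio-bound h²≤ ≤h²) ⟩
    2 * (n * (S * S) * (Q * Q)) * (9 * (n * (h * h)))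
      ≡⟨ solve 4 (λ n s q h → con 2 :* (n :* (s :* s) :* (q :* q)) :* (con 9 :* (n :* (h :* h)))
           := con 9 :* (n :* n :* (s :* s) :* (h :* h)) :* (con 2 :* (q :* q))) refl n S Q h ⟩
    9 * (n * n * (S * S) * (h * h)) * (2 * (Q * Q))
      ≤⟨ ℕ.*-monoʳ-≤ (9 * (n * n * (S * S) * (h * h))) √2≤ ⟩
    9 * (n * n * (S * S) * (h * h)) * (P * P)
      ≡⟨ solve 4 (λ n s h p → con 9 :* (n :* n :* (s :* s) :* (h :* h)) :* (p :* p)
           := (con 3 :* (p :* (s :* (n :* h)))) :* (con 3 :* (p :* (s :* (n :* h))))) refl n S h P ⟩
    (3 * (P * (S * (n * h)))) * (3 * (P * (S * (n * h)))) ∎)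

≤linear : ∀ n δ r → r + n ≤ 2 * δ + 2 → fromℕ r ℚ.≤ fromℕ 2 ℚ.* fromℕ δ ℚ.- fromℕ n ℚ.+ fromℕ 2
≤linear n δ r r≤ = *≤* (begin
  pos r ℤ.* (pos 1)             ≡⟨ ℤ.*-identityʳ (pos r) ⟩
  pos r
    ≡⟨ sym (trans (ℤ.+-assoc (pos r) (pos n) (ℤ.- pos n)) (trans (cong (ℤ._+_ (pos r)) (ℤ.+-inverseʳ (pos n))) (ℤ.+-identityʳ (pos r)))) ⟩
  (pos r ℤ.+ pos n) ℤ.- pos n     ≤⟨ ℤ.+-monoˡ-≤ (ℤ.- pos n) (+≤+ r≤) ⟩
  pos (2 * δ + 2) ℤ.- pos n     ≡⟨ ℤ.+-assoc (pos (2 * δ)) (pos 2) (ℤ.- pos n) ⟩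
  pos (2 * δ) ℤ.+ (pos 2 ℤ.- pos n) ≡⟨ cong (ℤ._+_ (pos (2 * δ))) (ℤ.+-comm (pos 2) (ℤ.- pos n)) ⟩
  pos (2 * δ) ℤ.+ (ℤ.- pos n ℤ.+ pos 2) ≡⟨ sym (ℤ.+-assoc (pos (2 * δ)) (ℤ.- pos n) (pos 2)) ⟩
  pos (2 * δ) ℤ.- pos n ℤ.+ pos 2 ≡⟨ cong (λ z → z ℤ.- pos n ℤ.+ pos 2) (ℤ.pos-* 2 δ) ⟩
  pos 2 ℤ.* pos δ ℤ.- pos n ℤ.+ pos 2
    ≡⟨ cong₂ (λ z z′ → z ℤ.+ z′ ℤ.+ pos 2) (sym (ℤ.*-identityʳ (pos 2 ℤ.* pos δ))) (sym (ℤ.*-identityʳ (ℤ.- pos n))) ⟩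
  (pos 2 ℤ.* pos δ) ℤ.* pos 1 ℤ.+ (ℤ.- pos n) ℤ.* pos 1 ℤ.+ pos 2
    ≡⟨ cong (ℤ._+ pos 2) (sym (ℤ.*-identityʳ ((pos 2 ℤ.* pos δ) ℤ.* pos 1 ℤ.+ (ℤ.- pos n) ℤ.* pos 1))) ⟩
  ((pos 2 ℤ.* pos δ) ℤ.* pos 1 ℤ.+ (ℤ.- pos n) ℤ.* pos 1) ℤ.* pos 1 ℤ.+ pos 2
    ≡⟨ sym (ℤ.*-identityʳ _) ⟩
  (((pos 2 ℤ.* pos δ) ℤ.* pos 1 ℤ.+ (ℤ.- pos n) ℤ.* pos 1) ℤ.* pos 1 ℤ.+ pos 2 ℤ.* pos 1) ℤ.* pos 1 ∎)
  where open ℤ.≤-Reasoning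

-- The rationals are a = P/Q and b = R/S. The first three clauses rule out b ≤ 0 and a < 0, so that
-- the claim reduces to natural numbers.
≤Bound⁺ : ∀ n h δ r .{{_ : NonZero n}} .{{_ : NonZero h}} →
          r + n ≤ 2 * δ + 2 →
          h * h ≤ 2 * n → n ≤ 2 * (h * h) →
          r * (n * h) ≤ δ * (h * h + n) + 3 * (n * h) →
          r ≤Bound[ n , δ ]
≤Bound⁺ n h δ r _ _ _ _ _ (mkℚᵘ (pos 0) _) {{()}}
≤Bound⁺ n h δ r _ _ _ _ _ (mkℚᵘ -[1+ _ ] _) {{()}}
≤Bound⁺ n h δ r _ _ _ _ (mkℚᵘ -[1+ _ ] _) (mkℚᵘ +[1+ _ ] _) (*≤* () , _) _
≤Bound⁺ n h δ r r≤₁ h²≤ ≤h² r≤₂ (mkℚᵘ (pos P) q) (mkℚᵘ +[1+ r′ ] s) (_ , *≤* √2≤) (*≤* ≤√n) =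
  ℚ.⊓-glb (≤linear n δ r r≤₁) (*≤* (begin
    pos r ℤ.* pos (D * 1)               ≡⟨ sym (ℤ.pos-* r (D * 1)) ⟩
    pos (r * (D * 1))                 ≤⟨ +≤+ nat ⟩
    pos ((((3 * P) * 1) * (δ * S) * 1 + 3 * D) * 1) ≡⟨ ℤ.pos-* ((((3 * P) * 1) * (δ * S) * 1 + 3 * D)) 1 ⟩
    pos (((3 * P) * 1) * (δ * S) * 1 + 3 * D) ℤ.* pos 1
      ≡⟨ cong (ℤ._* pos 1) (cong₂ ℤ._+_ numerator (ℤ.pos-* 3 D)) ⟩
    ((((pos 3 ℤ.* pos P) ℤ.* pos 1) ℤ.* (pos δ ℤ.* pos S)) ℤ.* pos 1 ℤ.+ pos 3 ℤ.* pos D) ℤ.* pos 1 ∎))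
  where
  open ℤ.≤-Reasoning
  Q = suc q
  R = suc r′
  S = suc s
  -- The common denominator 2QR, in the unreduced form that rational arithmetic produces.
  D = ((1 * Q) * 2) * (1 * R)
  numerator : pos (((3 * P) * 1) * (δ * S) * 1) ≡ (((pos 3 ℤ.* pos P) ℤ.* pos 1) ℤ.* (pos δ ℤ.* pos S)) ℤ.* pos 1
  numerator = trans (ℤ.pos-* (((3 * P) * 1) * (δ * S)) 1) (cong (ℤ._* pos 1) (trans (ℤ.pos-* ((3 * P) * 1) (δ * S))
    (cong₂ ℤ._*_ (trans (ℤ.pos-* (3 * P) 1) (cong (ℤ._* pos 1) (ℤ.pos-* 3 P))) (ℤ.pos-* δ S))))
  √2≤′ : 2 * (Q * Q) ≤ P * P
  √2≤′ = ℤ.drop‿+≤+ (subst₂ ℤ._≤_ (sym (ℤ.pos-* 2 (Q * Q))) (trans (ℤ.*-identityʳ (pos P ℤ.* pos P)) (sym (ℤ.pos-* P P))) √2≤)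
  ≤√n′ : R * R ≤ n * (S * S)
  ≤√n′ = ℤ.drop‿+≤+ (subst₂ ℤ._≤_ (trans (ℤ.*-identityʳ (pos R ℤ.* pos R)) (sym (ℤ.pos-* R R))) (sym (ℤ.pos-* n (S * S))) ≤√n)
  nat : r * (D * 1) ≤ (((3 * P) * 1) * (δ * S) * 1 + 3 * D) * 1
  nat = subst₂ _≤_
    (solve 3 (λ r q t → r :* (con 2 :* (q :* t))
         := r :* ((((con 1 :* q) :* con 2) :* (con 1 :* t)) :* con 1)) refl r Q R)
    (solve 5 (λ p s δ q t → con 3 :* (p :* (s :* δ)) :+ con 6 :* (q :* t) :=
       (((con 3 :* p) :* con 1) :* (δ :* s) :* con 1 :+ con 3 :* (((con 1 :* q) :* con 2) :* (con 1 :* t))) :* con 1) refl P S δ Q R)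
    (clear-roots {P} {Q} {R} {S} n h δ r √2≤′ ≤√n′ h²≤ ≤h² r≤₂)

-- D has `suc u` elements and the star adds `v` colours. Bounding one factor `n` by `p * h + h`
-- turns uhn into uph² + uh², at most δh² + 2nh; the star contributes at most δn.
sparse-count : ∀ {n h p δ u v} → n ≤ p * h + h → u * p ≤ δ → v * h ≤ δ → u ≤ h → h * h ≤ 2 * n →
  (suc u + v) * (n * h) ≤ suc δ * (h * h + n) + 3 * (n * h)
sparse-count {n} {h} {p} {δ} {u} {v} n≤ up≤ vh≤ u≤h h²≤ = begin
  (suc u + v) * (n * h)
    ≡⟨ solve 4 (λ u v n h → (con 1 :+ u :+ v) :* (n :* h)
         := n :* h :+ u :* h :* n :+ v :* h :* n) refl u v n h ⟩
  n * h + u * h * n + v * h * n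
    ≤⟨ ℕ.+-mono-≤ (ℕ.+-monoʳ-≤ (n * h) (ℕ.*-monoʳ-≤ (u * h) n≤)) (ℕ.*-monoˡ-≤ n vh≤) ⟩
  n * h + u * h * (p * h + h) + δ * n
    ≡⟨ solve 5 (λ u n h p δ → n :* h :+ u :* h :* (p :* h :+ h) :+ δ :* n
         := n :* h :+ ((u :* p) :* (h :* h) :+ u :* h :* h) :+ δ :* n) refl u n h p δ ⟩
  n * h + (u * p * (h * h) + u * h * h) + δ * n
    ≤⟨ ℕ.+-monoˡ-≤ (δ * n) (ℕ.+-monoʳ-≤ (n * h) (ℕ.+-mono-≤ (ℕ.*-monoˡ-≤ (h * h) up≤) (ℕ.*-monoˡ-≤ h (ℕ.≤-trans (ℕ.*-monoˡ-≤ h u≤h) h²≤)))) ⟩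
  n * h + (δ * (h * h) + 2 * n * h) + δ * n
    ≤⟨ ℕ.m≤m+n _ (h * h + n) ⟩
  n * h + (δ * (h * h) + 2 * n * h) + δ * n + (h * h + n)
    ≡⟨ solve 3 (λ n h δ → n :* h :+ (δ :* (h :* h) :+ con 2 :* n :* h) :+ δ :* n :+ (h :* h :+ n)
         := (con 1 :+ δ) :* (h :* h :+ n) :+ con 3 :* (n :* h)) refl n h δ ⟩
  suc δ * (h * h + n) + 3 * (n * h) ∎
  where open ℕ.≤-Reasoning

-- The same count for D = H. The hypothesis `h₁ * p ≤ δ` holds when the `h₁` elements other than 0
-- are too few to guarantee the degree.
dense-count : ∀ {n h₁ p δ v} → let h = suc h₁ in n ≤ p * h + h → h₁ * p ≤ δ → v * h ≤ δ → h * h ≤ 2 * n →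
  (h + v) * (n * h) ≤ suc δ * (h * h + n) + 3 * (n * h)
dense-count {n} {h₁} {p} {δ} {v} n≤ hp≤ vh≤ h²≤ = begin
  (h + v) * (n * h)
    ≡⟨ solve 3 (λ h₁ v n → (con 1 :+ h₁ :+ v) :* (n :* (con 1 :+ h₁))
         := (h₁ :* n :+ n) :* (con 1 :+ h₁) :+ v :* (con 1 :+ h₁) :* n) refl h₁ v n ⟩
  (h₁ * n + n) * h + v * h * n
    ≤⟨ ℕ.+-mono-≤ (ℕ.*-monoˡ-≤ h (ℕ.+-monoˡ-≤ n (ℕ.*-monoʳ-≤ h₁ n≤))) (ℕ.*-monoˡ-≤ n vh≤) ⟩
  (h₁ * (p * h + h) + n) * h + δ * n
    ≡⟨ cong (λ z → (z + n) * h + δ * n) (solve 3 (λ h₁ p h → h₁ :* (p :* h :+ h)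
         := h₁ :* p :* h :+ h₁ :* h) refl h₁ p h) ⟩
  (h₁ * p * h + h₁ * h + n) * h + δ * n
    ≤⟨ ℕ.+-monoˡ-≤ (δ * n) (ℕ.*-monoˡ-≤ h (ℕ.+-monoˡ-≤ n (ℕ.+-mono-≤ (ℕ.*-monoˡ-≤ h hp≤) (ℕ.≤-trans (ℕ.*-monoˡ-≤ h (ℕ.n≤1+n h₁)) h²≤)))) ⟩
  (δ * h + 2 * n + n) * h + δ * n
    ≤⟨ ℕ.m≤m+n _ (h * h + n) ⟩
  (δ * h + 2 * n + n) * h + δ * n + (h * h + n)
    ≡⟨ solve 3 (λ n h δ → (δ :* h :+ con 2 :* n :+ n) :* h :+ δ :* n :+ (h :* h :+ n)
         := (con 1 :+ δ) :* (h :* h :+ n) :+ con 3 :* (n :* h)) refl n h δ ⟩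
  suc δ * (h * h + n) + 3 * (n * h) ∎
  where
  open ℕ.≤-Reasoning
  h = suc h₁

-- Choice of parameters

m<n*[1+m/n] : ∀ m n .{{_ : NonZero n}} → m < n * suc (m / n)
m<n*[1+m/n] m n = begin-strict
  m                      ≡⟨ m≡m%n+[m/n]*n m n ⟩
  m % n + m / n * n      <⟨ ℕ.+-monoˡ-< (m / n * n) (m%n<n m n) ⟩
  n + m / n * n          ≡⟨ ℕ.*-comm (suc (m / n)) n ⟩
  n * suc (m / n)        ∎
  where open ℕ.≤-Reasoning

linear-colourable : ∀ N δ (3≤n : 3 ≤ suc N) → suc N ≤ 2 * δ → δ ≤ N →
  ∃[ k ] OddColourable (suc N) δ (cycle (suc N) 3≤n) k × k + suc N ≤ 2 * δ + 2
linear-colourable N (suc δ) 3≤n n≤2δ δ≤N with ℕ.m≤n⇒∃[o]m+o≡n δ≤N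
-- Here `N` is `suc δ`; the trivial group with D = H gives the complete graph.
... | zero , refl =
  _ , StarOverClasses.oddColourable (binary 0) N 0 δ (s≤s z≤n) δ≤N 3≤n (inj₁ refl) , (begin
    1 + δ / 1 + suc (suc δ + 0)      ≡⟨ cong (λ z → 1 + z + suc (suc δ + 0)) (n/1≡n δ) ⟩
    1 + δ + suc (suc δ + 0)          ≤⟨ ℕ.n≤1+n _ ⟩
    suc (1 + δ + suc (suc δ + 0))    ≡⟨ solve 1 (λ δ →
         con 1 :+ (con 1 :+ δ :+ (con 1 :+ ((con 1 :+ δ) :+ con 0)))
         := con 2 :* (con 1 :+ δ) :+ con 2) refl δ ⟩
    2 * suc δ + 2                    ∎)
  where open ℕ.≤-Reasoning
... | suc b , refl =
  s , TwoCliques.oddColourable N s a (cong (_+ a) (sym s+a)) (ℕ.m<n⇒0<n∸m a<) (s≤s z≤n) (sym s+a) 3≤n ,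
  ℕ.≤-reflexive (begin
    s + suc (suc δ + a)          ≡⟨ solve 3 (λ s δ a → s :+ (con 1 :+ ((con 1 :+ δ) :+ a))
         := (s :+ a) :+ (con 2 :+ δ)) refl s δ a ⟩
    (s + a) + suc (suc δ)        ≡⟨ cong (_+ suc (suc δ)) s+a ⟩
    suc (suc δ) + suc (suc δ)    ≡⟨ solve 1 (λ δ → (con 2 :+ δ) :+ (con 2 :+ δ)
         := con 2 :* (con 1 :+ δ) :+ con 2) refl δ ⟩
    2 * suc δ + 2                ∎)
  where
  open ≡-Reasoning
  -- A vertex in one private part misses exactly the `a` vertices of the other, so `a` is n - 1
  -- minus the degree `suc δ`, and `s` equals 2δ - n + 2 with `suc δ` in place of δ.
  a = suc b
  a< : a < suc (suc δ)
  a< = ℕ.m≤n⇒m≤1+n (ℕ.+-cancelˡ-≤ (suc δ) _ _ (ℕ.≤-trans (ℕ.≤-reflexive (ℕ.+-suc (suc δ) a))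
    (ℕ.≤-trans n≤2δ (ℕ.≤-reflexive (cong (suc δ +_) (ℕ.+-identityʳ (suc δ)))))))
  s = suc (suc δ) ∸ a
  s+a : s + a ≡ suc (suc δ)
  s+a = ℕ.m∸n+n≡m (ℕ.<⇒≤ a<)

-- D gets the least size that guarantees the degree, (δ + 1)/p rounded up. If the `h₁` elements
-- other than 0 are too few for this, D = H.
sqrt-colourable : ∀ N δ (3≤n : 3 ≤ suc N) → suc δ ≤ N → ∀ {h} .{{_ : NonZero h}} → XorGroup h → h * h ≤ 2 * suc N →
  ∃[ k ] OddColourable (suc N) (suc δ) (cycle (suc N) 3≤n) k ×
         k * (suc N * h) ≤ suc δ * (h * h + suc N) + 3 * (suc N * h)
sqrt-colourable N δ 3≤n δ≤N {h@(suc h₁)} X h²≤ = split (suc δ ℕ.≤? h₁ * p)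
  where
  n = suc N
  p = N / h
  n≤ : n ≤ p * h + h
  n≤ = ℕ.≤-trans (m<n*[1+m/n] N h) (ℕ.≤-reflexive (solve 2 (λ h p → h :* (con 1 :+ p)
       := p :* h :+ h) refl h p))
  split : Dec (suc δ ≤ h₁ * p) → ∃[ k ] OddColourable n (suc δ) (cycle n 3≤n) k ×
          k * (n * h) ≤ suc δ * (h * h + n) + 3 * (n * h)
  split (no  δ≰) =
    _ , StarOverClasses.oddColourable X N 0 δ (s≤s z≤n) δ≤N 3≤n (inj₁ refl) ,
    dense-count n≤ (ℕ.≤-pred (ℕ.≰⇒> δ≰)) (m/n*n≤m δ h) h²≤
  split (yes δ≤) =
    d + δ / h ,
    subst (λ z → OddColourable n (suc δ) (cycle n 3≤n) (z + δ / h)) h∸c≡d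
      (StarOverClasses.oddColourable X N c δ c<h δ≤N 3≤n
        (inj₂ (ℕ.m<n⇒0<n∸m d<h , subst (λ z → suc δ ≤ p * z) (sym h∸c≡d) (m<n*[1+m/n] δ p)))) ,
    sparse-count n≤ (m/n*n≤m δ p) (m/n*n≤m δ h) (ℕ.<⇒≤ (ℕ.<⇒≤ d<h)) h²≤
    where
    instance
      p≢0 : NonZero p
      p≢0 = ≢-nonZero λ p≡0 → ℕ.<⇒≱ δ≤ (ℕ.≤-trans (ℕ.≤-reflexive (trans (cong (h₁ *_) p≡0) (ℕ.*-zeroʳ h₁))) z≤n)
    d = suc (δ / p)
    d<h : d < h
    d<h = s≤s (m<n*o⇒m/o<n δ≤)
    c = h ∸ d
    c<h : c < h
    c<h = s≤s (ℕ.m∸n≤m h₁ (δ / p))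
    h∸c≡d : h ∸ c ≡ d
    h∸c≡d = ℕ.m∸[m∸n]≡n (ℕ.<⇒≤ d<h)

proposition1p2 : ∀ n (4≤n : 4 ≤ n) → 2 ∣ n →
    ∀ δ → n ≤ 2 * δ → δ ≤ n ∸ 1 →
    ∃[ r ] IsMinOddRamsey n δ (cycle n (≤-trans (n≤1+n 3) 4≤n)) r ×
    r ≤Bound[ n , δ ]
proposition1p2 (suc N) 4≤n _ (suc δ) n≤2δ δ≤N =
  let 3≤n = ≤-trans (n≤1+n 3) 4≤n
      -- Taking the power for 2n gives h² ≤ 2n < 4h², the range in which `ratio-bound` applies.
      m , h²≤ , <4h² = power-between {2 * suc N} (s≤s z≤n)
      h = 2 ^ m
      k₁ , ok₁ , k₁≤ = linear-colourable N (suc δ) 3≤n n≤2δ δ≤N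
      k₂ , ok₂ , k₂≤ = sqrt-colourable N δ 3≤n δ≤N {{ℕ.m^n≢0 2 m}} (binary m) h²≤
      -- The linear construction starts the search; the minimum found is at most `k₁` and at most
      -- `k₂`.
      r , r-min , r≤ = minOddRamsey ok₁
      n≤2h² = ℕ.*-cancelˡ-≤ 2 (≤-trans (ℕ.<⇒≤ <4h²)
        (ℕ.≤-reflexive (solve 1 (λ h → (con 2 :* h) :* (con 2 :* h) := con 2 :* (con 2 :* (h :* h))) refl h)))
  in r , r-min , ≤Bound⁺ (suc N) h (suc δ) r {{_}} {{ℕ.m^n≢0 2 m}}
       (≤-trans (ℕ.+-monoˡ-≤ (suc N) (r≤ k₁ ok₁)) k₁≤)
       h²≤ n≤2h²
       (≤-trans (ℕ.*-monoˡ-≤ (suc N * h) (r≤ k₂ ok₂)) k₂≤)
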